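{- Let $G$ be a finite simple graph. If $G$ contains $K_{134,12}$ as an induced minor, then $G$ contains a cycle of length at most $12$ or a theta as an induced subgraph.
   Context: $K_{a,b}$ is the complete bipartite graph with sides of sizes $a$ and $b$. A graph $H$ is an induced minor of $G$ if $H$ can be obtained from $G$ by repeatedly deleting vertices and contracting edges. A theta is a graph made of three internally vertex-disjoint chordless paths $P_1=a\dots b$, $P_2=a\dots b$, $P_3=a\dots b$, each of length (number of edges) at least two, such that no edges exist between the paths except the three edges incident to $a$ and the three edges incident to $b$. -}

module Defs where

open import Data.Nat using (ℕ; zero; suc; _+_; _≤_; _≡ᵇ_; _<ᵇ_)
open import Data.Bool using (Bool; true; false; _∧_; _∨_; not; _xor_)
open import Data.Fin using (Fin; toℕ; punchIn)
open import Data.Product using (Σ; _×_; ∃; ∃-syntax; _,_)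
open import Data.Sum using (_⊎_)
open import Relation.Binary.PropositionalEquality using (_≡_)
open import Function.Bundles using (_↔_; Inverse)
open import Function.Definitions using (Injective)

record Graph : Set where
  constructor mkGraph
  field
    size : ℕ
    adj  : Fin size → Fin size → Bool
open Graph public

record IsSimple (G : Graph) : Set where
  field
    irrefl : ∀ u → adj G u u ≡ false
    sym    : ∀ u v → adj G u v ≡ adj G v u

_==_ : ∀ {n} → Fin n → Fin n → Bool
i == j = toℕ i ≡ᵇ toℕ j

_≅_ : Graph → Graph → Set
H ≅ G = Σ (Fin (size H) ↔ Fin (size G)) λ f →
          ∀ i j → adj G (Inverse.to f i) (Inverse.to f j) ≡ adj H i j

delete : (G : Graph) {m : ℕ} → size G ≡ suc m → Fin (size G) → Graph
delete (mkGraph .(suc m) A) {m} _≡_.refl v =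
  mkGraph m (λ i j → A (punchIn v i) (punchIn v j))

-- Contracting the edge uv: v is removed and its neighbours become
-- neighbours of u (the merged vertex); no loops are created.
contract : (G : Graph) {m : ℕ} → size G ≡ suc m → Fin (size G) → Fin (size G) → Graph
contract (mkGraph .(suc m) A) {m} _≡_.refl u v =
  mkGraph m (λ i j →
    let x = punchIn v i ; y = punchIn v j in
    not (i == j) ∧ (A x y ∨ ((x == u) ∧ A v y) ∨ ((y == u) ∧ A x v)))

data _≼_ (H G : Graph) : Set where
  done     : H ≅ G → H ≼ G
  del      : ∀ {m} (e : size G ≡ suc m) (v : Fin (size G)) →
             H ≼ delete G e v → H ≼ G
  contr    : ∀ {m} (e : size G ≡ suc m) (u v : Fin (size G)) →
             adj G u v ≡ true → H ≼ contract G e u v → H ≼ G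

_⊑ᵢ_ : Graph → Graph → Set
H ⊑ᵢ G = Σ (Fin (size H) → Fin (size G)) λ f →
           Injective _≡_ _≡_ f × (∀ i j → adj G (f i) (f j) ≡ adj H i j)

K : ℕ → ℕ → Graph
K a b = mkGraph (a + b) (λ i j → (toℕ i <ᵇ a) xor (toℕ j <ᵇ a))

nextMod : ℕ → ℕ → ℕ
nextMod k i = Data.Bool.if (suc i ≡ᵇ k) then 0 else suc i
  where import Data.Bool

C : ℕ → Graph
C k = mkGraph k (λ i j → (toℕ j ≡ᵇ nextMod k (toℕ i)) ∨ (toℕ i ≡ᵇ nextMod k (toℕ j)))

-- Theta with paths having x, y, z ≥ 1 internal vertices (lengths x+1, y+1, z+1).
-- Vertex 0 = a, vertex 1 = b, path 1 internals 2..x+1, path 2 internals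
-- x+2..x+y+1, path 3 internals x+y+2..x+y+z+1, each traversed from a to b.
thetaDir : ℕ → ℕ → ℕ → ℕ → ℕ → Bool
thetaDir x y z u v =
  let s1 = 2 ; s2 = 2 + x ; s3 = 2 + x + y
      e1 = 1 + x ; e2 = 1 + x + y ; e3 = 1 + x + y + z in
  ((u ≡ᵇ 0) ∧ ((v ≡ᵇ s1) ∨ (v ≡ᵇ s2) ∨ (v ≡ᵇ s3)))
  ∨ ((v ≡ᵇ 1) ∧ ((u ≡ᵇ e1) ∨ (u ≡ᵇ e2) ∨ (u ≡ᵇ e3)))
  ∨ ((v ≡ᵇ suc u) ∧ (1 <ᵇ u) ∧ (u <ᵇ e3)
       ∧ not (u ≡ᵇ e1) ∧ not (u ≡ᵇ e2))

Theta : ℕ → ℕ → ℕ → Graph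
Theta x y z = mkGraph (2 + x + y + z)
  (λ i j → thetaDir x y z (toℕ i) (toℕ j) ∨ thetaDir x y z (toℕ j) (toℕ i))

-- Of the short cycles only the triangle matters: let G be triangle-free, with bags A i and B j.
-- Inside A i grow a connected set vertex by vertex, maintaining a vertex or edge xy that touches
-- every B j touched by the set.  Either this survives until all B j are touched, or it produces a
-- long link for some j < k: a connected part of A i whose only vertices touching B j and B k are
-- two distinct nonadjacent vertices q and q′.
-- Since 134 > 2 · 66 + 1, three bags A i have long links for the same pair j, k, or two bags A i
-- have edges touching every B j.  In the first case the three ends q are joined inside B j by three
-- disjoint legs from a common centre, the three ends q′ likewise inside B k, and the centres are
-- those of a theta.  In the second case, since 12 > 2 · 4, one end of each of the two edges
-- can be chosen so that both touch the same three B j, which makes these two ends the centres.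

module Submission where

open import Defs
open import Data.Bool using (Bool; true; false; not; _∧_; _∨_; _xor_; if_then_else_)
import Data.Bool as Bool
import Data.Bool.Properties as Bool
open import Data.Fin using (Fin; zero; suc; toℕ; fromℕ<; punchIn; _↑ˡ_; _↑ʳ_)
import Data.Fin as Fin
import Data.Fin.Properties as Fin
open import Data.List using (List; []; _∷_; length; filter; map; allFin; cartesianProduct)
open import Data.List.Membership.Propositional using (_∈_)
open import Data.List.Membership.Propositional.Properties
  using (∈-allFin; ∈-filter⁺; ∈-filter⁻; ∈-cartesianProduct⁺; ∈-map⁺)
open import Data.List.Properties using (length-tabulate)
open import Data.List.Relation.Unary.All as All using (All; []; _∷_)
open import Data.List.Relation.Unary.All.Properties using (all-filter)
open import Data.List.Relation.Unary.AllPairs using ([]; _∷_)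
open import Data.List.Relation.Unary.Any using (here; there)
open import Data.List.Relation.Unary.Unique.Propositional using (Unique)
open import Data.List.Relation.Unary.Unique.Propositional.Properties using (filter⁺; allFin⁺)
open import Data.Maybe using (Maybe; just; nothing)
import Data.Maybe.Properties as Maybe
open import Data.Nat
  using (ℕ; zero; suc; _+_; _∸_; _≤_; _<_; _≡ᵇ_; _<ᵇ_; z≤n; s≤s; z<s; s<s; s≤s⁻¹; _<?_)
open import Data.Nat.ListAction using (sum)
import Data.Nat.Properties as ℕ
open import Data.Product using (Σ; _×_; ∃-syntax; _,_; proj₁; proj₂)
import Data.Product.Properties as Product
open import Data.Sum using (_⊎_; inj₁; inj₂; [_,_]′)
import Data.Sum as Sum
open import Function using (_∘_; id; case_of_)
open import Function.Bundles using (Inverse; Equivalence; mk⇔)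
open import Function.Definitions using (Injective)
open import Relation.Binary.Definitions using (tri<; tri≈; tri>; DecidableEquality)
open import Relation.Binary.PropositionalEquality
  using (_≡_; _≢_; refl; sym; trans; cong; cong₂; subst; subst₂; ≢-sym)
open import Relation.Nullary using (¬_; Dec; yes; no; contradiction)
open import Relation.Nullary.Decidable using (does; _×-dec_; _⊎-dec_; ¬?)
open import Relation.Unary using (Decidable)

Vertex : Graph → Set
Vertex G = Fin (size G)

-- Walks inside a region

data Walk (G : Graph) (D : Vertex G → Set) : Vertex G → Vertex G → Set where
  [_]    : ∀ {u} → D u → Walk G D u u
  _∷⟨_⟩_ : ∀ {u v w} → D u → adj G u v ≡ true → Walk G D v w → Walk G D u w

infixr 5 _∷⟨_⟩_

module _ {G : Graph} {D : Vertex G → Set} where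

  infixr 5 _++ʷ_

  first∈ : ∀ {u v} → Walk G D u v → D u
  first∈ [ d ]          = d
  first∈ (d ∷⟨ _ ⟩ _) = d

  last∈ : ∀ {u v} → Walk G D u v → D v
  last∈ [ d ]          = d
  last∈ (_ ∷⟨ _ ⟩ p) = last∈ p

  mapʷ : ∀ {E : Vertex G → Set} {u v} → (∀ {z} → D z → E z) → Walk G D u v → Walk G E u v
  mapʷ f [ d ]          = [ f d ]
  mapʷ f (d ∷⟨ e ⟩ p) = f d ∷⟨ e ⟩ mapʷ f p

  _++ʷ_ : ∀ {u v w} → Walk G D u v → Walk G D v w → Walk G D u w
  [ _ ]          ++ʷ q = q
  (d ∷⟨ e ⟩ p) ++ʷ q = d ∷⟨ e ⟩ (p ++ʷ q)

  snoc : ∀ {u v w} → Walk G D u v → adj G v w ≡ true → D w → Walk G D u w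
  snoc p e d = p ++ʷ last∈ p ∷⟨ e ⟩ [ d ]

  -- Cut the walk at its first vertex in `Hit`. The new region remembers that `t` is the only such
  -- vertex left; claws, long links and `approach` all rest on this.
  first-hit : ∀ {Hit : Vertex G → Set} {u v} → Decidable Hit → Walk G D u v → Hit v →
              ∃[ t ] (Hit t × Walk G (λ z → D z × (Hit z → z ≡ t)) u t)
  first-hit hit? [ d ] h = _ , h , [ d , (λ _ → refl) ]
  first-hit {u = u} hit? (d ∷⟨ e ⟩ p) h with hit? u
  ... | yes hu = u , hu , [ d , (λ _ → refl) ]
  ... | no ¬hu with t , ht , q ← first-hit hit? p h =
          t , ht , (d , λ hu → contradiction hu ¬hu) ∷⟨ e ⟩ q

module _ {G : Graph} (simple : IsSimple G) {D : Vertex G → Set} where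

  open IsSimple simple renaming (sym to adj-sym)

  reverseʷ : ∀ {u v} → Walk G D u v → Walk G D v u
  reverseʷ [ d ]          = [ d ]
  reverseʷ (d ∷⟨ e ⟩ p) = snoc (reverseʷ p) (trans (adj-sym _ _) e) d

-- Induced minor models

-- The bags are the branch sets of an induced minor. Unlike the operations of `≼`, they show the
-- whole minor inside `G` at once. Inducedness enters through `nonedge`, and `bag?` permits
-- searching for vertices that touch a bag.
record Model (H G : Graph) : Set₁ where
  field
    bag       : Vertex H → Vertex G → Set
    bag?      : ∀ i → Decidable (bag i)
    disjoint  : ∀ {i j v} → bag i v → bag j v → i ≡ j
    connected : ∀ {i u v} → bag i u → bag i v → Walk G (bag i) u v
    edge      : ∀ {i j} → adj H i j ≡ true → ∃[ u ] ∃[ v ] (bag i u × bag j v × adj G u v ≡ true)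
    nonedge   : ∀ {i j u v} → i ≢ j → adj H i j ≡ false → bag i u → bag j v → adj G u v ≡ false

open Model

⊑ᵢ⇒Model : ∀ {H G} → H ⊑ᵢ G → Model H G
⊑ᵢ⇒Model (f , inj , pres) = record
  { bag       = λ i v → f i ≡ v
  ; bag?      = λ i v → f i Fin.≟ v
  ; disjoint  = λ { refl q → inj (sym q) }
  ; connected = λ { refl refl → [ refl ] }
  ; edge      = λ e → _ , _ , refl , refl , trans (pres _ _) e
  ; nonedge   = λ { _ ne refl refl → trans (pres _ _) ne }
  }

-- Each edge of the walk in `H` is crossed along an edge between two bags; inside a bag,
-- connectedness links arrival to departure.
liftWalk : ∀ {H G} (N : Model H G) {D : Vertex H → Set} {i j u v} → Walk H D i j →
           bag N i u → bag N j v → Walk G (λ z → ∃[ x ] (D x × bag N x z)) u v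
liftWalk N [ d ] bu bv = mapʷ (λ b → _ , d , b) (connected N bu bv)
liftWalk N (d ∷⟨ e ⟩ p) bu bv with _ , _ , bx , by , e′ ← edge N e =
  snoc (mapʷ (λ b → _ , d , b) (connected N bu bx)) e′ (_ , first∈ p , by) ++ʷ liftWalk N p by bv

Model-trans : ∀ {H G F} → Model H G → Model G F → Model H F
Model-trans M N = record
  { bag       = λ i v → ∃[ x ] (bag M i x × bag N x v)
  ; bag?      = λ i v → Fin.any? (λ x → bag? M i x ×-dec bag? N x v)
  ; disjoint  = λ { (x , m , n) (y , m′ , n′) →
                  disjoint M m (subst (bag M _) (disjoint N n′ n) m′) }
  ; connected = λ { (x , m , n) (y , m′ , n′) → liftWalk N (connected M m m′) n n′ }
  ; edge      = λ e → let _ , _ , mx , my , e₁ = edge M e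
                          _ , _ , nu , nv , e₂ = edge N e₁
                      in _ , _ , (_ , mx , nu) , (_ , my , nv) , e₂
  ; nonedge   = λ { i≢j ne (x , m , n) (y , m′ , n′) →
                  nonedge N (λ { refl → i≢j (disjoint M m m′) }) (nonedge M i≢j ne m m′) n n′ }
  }

==-sound : ∀ {n} (i j : Fin n) → (i == j) ≡ true → i ≡ j
==-sound i j e = Fin.toℕ-injective (ℕ.≡ᵇ⇒≡ _ _ (Equivalence.from Bool.T-≡ e))

==-complete : ∀ {n} (i : Fin n) → (i == i) ≡ true
==-complete i = Equivalence.to Bool.T-≡ (ℕ.≡⇒≡ᵇ (toℕ i) _ refl)

==-sym : ∀ {n} (i j : Fin n) → (i == j) ≡ (j == i)
==-sym i j = Bool.⇔→≡ (mk⇔ (flip i j) (flip j i))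
  where
  flip : ∀ i j → (i == j) ≡ true → (j == i) ≡ true
  flip i j e rewrite ==-sound i j e = ==-complete j

≢⇒== : ∀ {n} {i j : Fin n} → i ≢ j → (i == j) ≡ false
≢⇒== i≢j = Bool.¬-not (i≢j ∘ ==-sound _ _)

module Contraction {m : ℕ} (A : Fin (suc m) → Fin (suc m) → Bool)
                   (simple : IsSimple (mkGraph (suc m) A))
                   (u v : Fin (suc m)) (uv : A u v ≡ true) where

  private
    G G/uv : Graph
    G    = mkGraph (suc m) A
    G/uv = contract G refl u v

  open IsSimple simple renaming (sym to A-sym)

  contract-simple : IsSimple G/uv
  contract-simple = record
    { irrefl = λ i → absorbed _ (==-complete i)
    ; sym    = λ i j → cong₂ (λ b c → not b ∧ c) (==-sym i j)
                 (cong₂ _∨_ (A-sym _ _)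
                   (trans (Bool.∨-comm ((punchIn v i == u) ∧ _) _)
                     (cong₂ _∨_ (cong ((punchIn v j == u) ∧_) (A-sym _ _))
                                (cong ((punchIn v i == u) ∧_) (A-sym _ _)))))
    }
    where
    absorbed : ∀ {b} c → b ≡ true → not b ∧ c ≡ false
    absorbed _ refl = refl

  -- `punchIn v` numbers the vertices other than `v`; the removed `v` joins the bag of `u`.
  Bag : Fin m → Fin (suc m) → Set
  Bag x z = punchIn v x ≡ z ⊎ (z ≡ v × punchIn v x ≡ u)

  joined : ∀ x → punchIn v x ≡ u → Walk G (Bag x) (punchIn v x) v
  joined x refl = inj₁ refl ∷⟨ uv ⟩ [ inj₂ (refl , refl) ]

  link : ∀ {x z w} → Bag x z → Bag x w → Walk G (Bag x) z w
  link (inj₁ refl)       (inj₁ refl)       = [ inj₁ refl ]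
  link (inj₁ refl)       (inj₂ (refl , e)) = joined _ e
  link (inj₂ (refl , e)) (inj₁ refl)       = reverseʷ simple (joined _ e)
  link (inj₂ (refl , e)) (inj₂ (refl , _)) = [ inj₂ (refl , e) ]

  bag-edge : ∀ i j → adj G/uv i j ≡ true →
             ∃[ z ] ∃[ w ] (Bag i z × Bag j w × A z w ≡ true)
  bag-edge i j e with i == j | A (punchIn v i) (punchIn v j) in e₁
                    | punchIn v i == u in e₂ | A v (punchIn v j) in e₃
                    | punchIn v j == u in e₄ | A (punchIn v i) v in e₅
  ... | false | true  | _    | _    | _    | _    = _ , _ , inj₁ refl , inj₁ refl , e₁
  ... | false | false | true | true | _    | _    =
    _ , _ , inj₂ (refl , ==-sound _ _ e₂) , inj₁ refl , e₃
  ... | false | false | true | false | true | true =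
    _ , _ , inj₁ refl , inj₂ (refl , ==-sound _ _ e₄) , e₅
  ... | false | false | false | _   | true | true =
    _ , _ , inj₁ refl , inj₂ (refl , ==-sound _ _ e₄) , e₅

  bag-nonedge : ∀ {i j z w} → i ≢ j → adj G/uv i j ≡ false → Bag i z → Bag j w → A z w ≡ false
  bag-nonedge {i} {j} i≢j ne p q rewrite ≢⇒== i≢j = go p q
    where
    left : ∀ a {b} → a ∨ b ≡ false → a ≡ false
    left false _ = refl
    right : ∀ a {b} → a ∨ b ≡ false → b ≡ false
    right false e = e
    go : ∀ {z w} → Bag i z → Bag j w → A z w ≡ false
    go (inj₁ refl) (inj₁ refl) = left _ ne
    go (inj₁ refl) (inj₂ (refl , e)) =
      subst (λ b → b ∧ A (punchIn v i) v ≡ false)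
        (trans (cong (_== u) e) (==-complete u))
        (right ((punchIn v i == u) ∧ _) (right (A (punchIn v i) (punchIn v j)) ne))
    go (inj₂ (refl , e)) (inj₁ refl) =
      subst (λ b → b ∧ A v (punchIn v j) ≡ false)
        (trans (cong (_== u) e) (==-complete u))
        (left ((punchIn v i == u) ∧ _) (right (A (punchIn v i) (punchIn v j)) ne))
    go (inj₂ (refl , e)) (inj₂ (refl , f)) =
      contradiction (Fin.punchIn-injective v i j (trans e (sym f))) i≢j

  contract-model : Model G/uv G
  contract-model = record
    { bag       = Bag
    ; bag?      = λ x z → (punchIn v x Fin.≟ z) ⊎-dec ((z Fin.≟ v) ×-dec (punchIn v x Fin.≟ u))
    ; disjoint  = disj
    ; connected = link
    ; edge      = bag-edge _ _
    ; nonedge   = bag-nonedge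
    }
    where
    disj : ∀ {i j z} → Bag i z → Bag j z → i ≡ j
    disj (inj₁ refl)       (inj₁ e)       = Fin.punchIn-injective v _ _ (sym e)
    disj (inj₁ refl)       (inj₂ (e , _)) = contradiction e (Fin.punchInᵢ≢i v _)
    disj (inj₂ (refl , _)) (inj₁ e)       = contradiction e (Fin.punchInᵢ≢i v _)
    disj (inj₂ (_ , e))    (inj₂ (_ , f)) = Fin.punchIn-injective v _ _ (trans e (sym f))

-- A deletion is an induced subgraph, a contraction has `contract-model`, and models compose.
-- Simplicity is passed along because the bag of a contracted edge is walked in both directions.
≼⇒Model : ∀ {H G} → IsSimple G → H ≼ G → Model H G
≼⇒Model _ (done (f , pres)) = ⊑ᵢ⇒Model (Inverse.to f , injective , pres)
  where
  injective : Injective _≡_ _≡_ (Inverse.to f)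
  injective {i} {j} e = trans (sym (Inverse.strictlyInverseʳ f i))
                          (trans (cong (Inverse.from f) e) (Inverse.strictlyInverseʳ f j))
≼⇒Model {G = mkGraph _ A} simple (del refl v p) =
  Model-trans
    (≼⇒Model (record { irrefl = λ i → IsSimple.irrefl simple _
                     ; sym = λ i j → IsSimple.sym simple _ _ }) p)
    (⊑ᵢ⇒Model (punchIn v , Fin.punchIn-injective v _ _ , λ _ _ → refl))
≼⇒Model {G = mkGraph _ A} simple (contr refl u v uv p) =
  Model-trans (≼⇒Model contract-simple p) contract-model
  where open Contraction A simple u v uv

-- Induced paths and thetas

last-index : ∀ {P : ℕ → Set} → Decidable P → ∀ n → ∃[ i ] (i ≤ n × P i) →
             ∃[ s ] (s ≤ n × P s × (∀ {j} → s < j → j ≤ n → ¬ P j))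
last-index P? n (i , i≤n , Pi) with P? n
last-index P? n       _              | yes Pn =
  n , ℕ.≤-refl , Pn , λ n<j j≤n _ → ℕ.<⇒≱ n<j j≤n
last-index P? zero    (_ , z≤n , Pi) | no ¬Pn = contradiction Pi ¬Pn
last-index {P} P? (suc n) (i , i≤n , Pi) | no ¬Pn
  with s , s≤n , Ps , above ← last-index P? n (i , s≤s⁻¹ (ℕ.≤∧≢⇒< i≤n λ { refl → ¬Pn Pi }) , Pi) =
  s , ℕ.m≤n⇒m≤1+n s≤n , Ps , λ s<j j≤ → case ℕ.m≤n⇒m<n∨m≡n j≤ of λ where
    (inj₁ j<) → above s<j (s≤s⁻¹ j<)
    (inj₂ refl) → ¬Pn

first-index : ∀ {P : ℕ → Set} → Decidable P → ∀ n → ∃[ i ] (i ≤ n × P i) →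
              ∃[ s ] (s ≤ n × P s × (∀ {j} → j < s → ¬ P j))
first-index P? n (i , i≤n , Pi) with P? zero
... | yes P0 = zero , z≤n , P0 , λ ()
first-index P? n       (zero  , _       , Pi) | no ¬P0 = contradiction Pi ¬P0
first-index P? (suc n) (suc i , s≤s i≤n , Pi) | no ¬P0
  with s , s≤n , Ps , below ← first-index (P? ∘ suc) n (i , i≤n , Pi) =
  suc s , s≤s s≤n , Ps , λ { {zero} _ → ¬P0 ; {suc j} (s≤s j<) → below j< }

-- A path is a function on all of `ℕ`, so that suffixes are mere shifts; only the values up to `len`
-- have a meaning. Chordlessness is `far`.
record InducedPath (G : Graph) (D : Vertex G → Set) (u v : Vertex G) : Set where
  field
    len      : ℕ
    at       : ℕ → Vertex G
    start    : at 0 ≡ u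
    end      : at len ≡ v
    inside   : ∀ {i} → i ≤ len → D (at i)
    step     : ∀ {i} → i < len → adj G (at i) (at (suc i)) ≡ true
    far      : ∀ {i j} → suc i < j → j ≤ len → adj G (at i) (at j) ≢ true
    distinct : ∀ {i j} → i < j → j ≤ len → at i ≢ at j

  at-injective : ∀ {i j} → i ≤ len → j ≤ len → at i ≡ at j → i ≡ j
  at-injective {i} {j} i≤ j≤ e with ℕ.<-cmp i j
  ... | tri< i<j _ _ = contradiction e (distinct i<j j≤)
  ... | tri≈ _ i≡j _ = i≡j
  ... | tri> _ _ j<i = contradiction (sym e) (distinct j<i i≤)

  segment : ∀ i d → d + i ≤ len →
            Walk G (λ z → ∃[ m ] (i ≤ m × m ≤ d + i × z ≡ at m)) (at i) (at (d + i))
  segment i zero    _ = [ i , ℕ.≤-refl , ℕ.≤-refl , refl ]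
  segment i (suc d) d< =
    snoc (mapʷ (λ { (m , i≤m , m≤ , e) → m , i≤m , ℕ.m≤n⇒m≤1+n m≤ , e }) (segment i d (ℕ.<⇒≤ d<)))
         (step d<) (suc (d + i) , ℕ.m≤n+m i (suc d) , ℕ.≤-refl , refl)

  range : ∀ {i j} → i ≤ j → j ≤ len → Walk G (λ z → ∃[ m ] (i ≤ m × m ≤ j × z ≡ at m)) (at i) (at j)
  range {i} {j} i≤j j≤ =
    subst (λ k → k ≤ len → Walk G (λ z → ∃[ m ] (i ≤ m × m ≤ k × z ≡ at m)) (at i) (at k))
          (ℕ.m∸n+n≡m i≤j) (segment i (j ∸ i)) j≤

-- Positions of the vertices of a theta whose paths have suc (ℓ i) internal vertices

module Slots (ℓ : Fin 3 → ℕ) where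

  count : Fin 3 → ℕ
  count i = suc (ℓ i)

  private
    x y z : ℕ
    x = count zero
    y = count (suc zero)
    z = count (suc (suc zero))

  off : Fin 3 → ℕ
  off zero             = 0
  off (suc zero)       = x
  off (suc (suc zero)) = x + y

  data Slot : Set where
    source target : Slot
    inner : ∀ i m → m < count i → Slot

  code : Slot → ℕ
  code source        = 0
  code target        = 1
  code (inner i m _) = 2 + (off i + m)

  -- The edges of the theta directed from source to target, by structure rather than arithmetic;
  -- `arc⇒↦` and `↦⇒arc` translate from and to the numbering of `Theta`.
  data _↦_ : Slot → Slot → Set where
    leave : ∀ {i p} → source ↦ inner i 0 p
    move  : ∀ {i m p q} → inner i m p ↦ inner i (suc m) q
    enter : ∀ {i p} → inner i (ℓ i) p ↦ target

  off-mono : ∀ {i j} → i Fin.< j → off i + count i ≤ off j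
  off-mono {zero}     {suc zero}       _ = ℕ.≤-refl
  off-mono {zero}     {suc (suc zero)} _ = ℕ.m≤m+n x y
  off-mono {suc zero} {suc (suc zero)} _ = ℕ.≤-refl
  off-mono {suc zero} {suc zero} (s≤s ())
  off-mono {suc (suc zero)} {suc zero} (s≤s ())
  off-mono {suc (suc zero)} {suc (suc zero)} (s≤s (s≤s ()))

  off-disjoint : ∀ {i j m n} → i Fin.< j → m < count i → off i + m ≢ off j + n
  off-disjoint {i} {j} {m} {n} i<j m< = ℕ.<⇒≢
    (ℕ.<-≤-trans (ℕ.+-monoʳ-< (off i) m<) (ℕ.≤-trans (off-mono i<j) (ℕ.m≤m+n (off j) n)))

  -- The three paths occupy disjoint intervals of positions.
  off-unique : ∀ {i j m n} → off i + m ≡ off j + n → m < count i → n < count j → i ≡ j × m ≡ n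
  off-unique {i} {j} e m< n< with Fin.<-cmp i j
  ... | tri< i<j _ _    = contradiction e (off-disjoint i<j m<)
  ... | tri≈ _ refl _   = refl , ℕ.+-cancelˡ-≡ (off i) _ _ e
  ... | tri> _ _ j<i    = contradiction (sym e) (off-disjoint j<i n<)

  locate : ∀ n → n < 2 + x + y + z → ∃[ s ] (code s ≡ n)
  locate zero          _ = source , refl
  locate (suc zero)    _ = target , refl
  locate (suc (suc p)) (s≤s (s≤s p<)) with p <? x | p <? x + y
  ... | yes p<x | _       = inner zero p p<x , refl
  ... | no  p≮x | yes p<y =
    inner (suc zero) (p ∸ x) (ℕ.+-cancelˡ-< x _ _ (subst (_< x + y) (sym e) p<y)) , cong (2 +_) e
    where e = ℕ.m+[n∸m]≡n (ℕ.≮⇒≥ p≮x)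
  ... | no  _   | no  p≮y =
    inner (suc (suc zero)) (p ∸ (x + y)) (ℕ.+-cancelˡ-< (x + y) _ _ (subst (_< x + y + z) (sym e) p<))
    , cong (2 +_) e
    where e = ℕ.m+[n∸m]≡n (ℕ.≮⇒≥ p≮y)

  private
    -- These reduce to `s1`, `s2`, `s3` and `e1`, `e2`, `e3` of `thetaDir`, taken at the three
    -- counts.
    starts ends : Fin 3 → ℕ
    starts k = 2 + off k
    ends   k = 1 + (off k + count k)

    OneOf : (Fin 3 → ℕ) → ℕ → Set
    OneOf f n = n ≡ f zero ⊎ n ≡ f (suc zero) ⊎ n ≡ f (suc (suc zero))

    one-of⁻ : ∀ (f : Fin 3 → ℕ) {n} → OneOf f n → ∃[ k ] (n ≡ f k)
    one-of⁻ f (inj₁ e)        = _ , e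
    one-of⁻ f (inj₂ (inj₁ e)) = _ , e
    one-of⁻ f (inj₂ (inj₂ e)) = _ , e

    one-of⁺ : ∀ (f : Fin 3 → ℕ) {n} k → n ≡ f k → OneOf f n
    one-of⁺ f zero             = inj₁
    one-of⁺ f (suc zero)       = inj₂ ∘ inj₁
    one-of⁺ f (suc (suc zero)) = inj₂ ∘ inj₂

    one-of? : ∀ (f : Fin 3 → ℕ) n → Dec (OneOf f n)
    one-of? f n = (n ℕ.≟ f zero) ⊎-dec (n ℕ.≟ f (suc zero)) ⊎-dec (n ℕ.≟ f (suc (suc zero)))

  Arc : ℕ → ℕ → Set
  Arc u v = (u ≡ 0 × OneOf starts v)
          ⊎ (v ≡ 1 × OneOf ends u)
          ⊎ (v ≡ suc u × 1 < u × u < ends (suc (suc zero)) × u ≢ ends zero × u ≢ ends (suc zero))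

  -- does (arc? u v) is definitionally thetaDir x y z u v.
  arc? : ∀ u v → Dec (Arc u v)
  arc? u v = ((u ℕ.≟ 0) ×-dec one-of? starts v)
       ⊎-dec ((v ℕ.≟ 1) ×-dec one-of? ends u)
       ⊎-dec ((v ℕ.≟ suc u) ×-dec (1 <? u) ×-dec (u <? ends (suc (suc zero)))
              ×-dec ¬? (u ℕ.≟ ends zero) ×-dec ¬? (u ℕ.≟ ends (suc zero)))

  last-position : ∀ k → ends k ≡ code (inner k (ℓ k) ℕ.≤-refl)
  last-position k = cong suc (ℕ.+-suc (off k) (ℓ k))

  arc⇒↦ : ∀ s t → Arc (code s) (code t) → s ↦ t
  arc⇒↦ source t (inj₁ (_ , o)) with t | one-of⁻ starts o
  ... | inner i m m< | k , e
    with refl , refl ← off-unique {i} {k} (trans (cong (_∸ 2) e) (sym (ℕ.+-identityʳ (off k)))) m< z<s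
    = leave
  arc⇒↦ s target (inj₂ (inj₁ (_ , o))) with s | one-of⁻ ends o
  ... | source | _ , ()
  ... | target | k , e with () ← trans e (last-position k)
  ... | inner i m m< | k , e
    with refl , refl ← off-unique {i} {k} (cong (_∸ 2) (trans e (last-position k))) m< ℕ.≤-refl
    = enter
  arc⇒↦ target _ (inj₂ (inj₂ (_ , s≤s () , _)))
  arc⇒↦ (inner i m m<) (inner j n n<) (inj₂ (inj₂ (next , _ , below , not1 , not2)))
    with ℕ.m≤n⇒m<n∨m≡n m<
  ... | inj₁ sm<
    with refl , refl ← off-unique {j} {i} (trans (cong (_∸ 2) next) (sym (ℕ.+-suc (off i) m))) n< sm<
    = move
  -- From the last place of a path, an arc to the next number is ruled out by `not1`, by `not2` or,
  -- on the third path, by `below`.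
  ... | inj₂ refl = contradiction (sym (last-position i)) (last-of i)
    where
    last-of : ∀ k → code (inner i m m<) ≢ ends k
    last-of zero             = not1
    last-of (suc zero)       = not2
    last-of (suc (suc zero)) = ℕ.<⇒≢ below

  ↦⇒arc : ∀ {s t} → s ↦ t → Arc (code s) (code t)
  ↦⇒arc (leave {i}) = inj₁ (refl , one-of⁺ starts i (cong (2 +_) (ℕ.+-identityʳ (off i))))
  ↦⇒arc (enter {i}) = inj₂ (inj₁ (refl , one-of⁺ ends i (sym (last-position i))))
  ↦⇒arc (move {i} {m} {p} {q}) =
    inj₂ (inj₂ (cong (2 +_) (ℕ.+-suc (off i) m) , s<s z<s
               , s<s (subst (_< x + y + z) (ℕ.+-suc (off i) m)
                      (ℕ.<-≤-trans (ℕ.+-monoʳ-< (off i) q) (bound i)))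
               , not-end zero , not-end (suc zero)))
    where
    bound : ∀ i → off i + count i ≤ x + y + z
    bound zero             = ℕ.≤-trans (ℕ.m≤m+n x y) (ℕ.m≤m+n (x + y) z)
    bound (suc zero)       = ℕ.m≤m+n (x + y) z
    bound (suc (suc zero)) = ℕ.≤-refl
    not-end : ∀ k → code (inner i m p) ≢ ends k
    not-end k e
      with refl , refl ← off-unique {i} {k} (cong (_∸ 2) (trans e (last-position k))) p ℕ.≤-refl =
      ℕ.<-irrefl refl q

pairwise : ∀ {R : Fin 3 → Fin 3 → Set} → (∀ {i j} → R i j → R j i) →
           R zero (suc zero) → R zero (suc (suc zero)) → R (suc zero) (suc (suc zero)) →
           ∀ {i j} → i ≢ j → R i j
pairwise s r₁ r₂ r₃ {zero}           {zero}           n = contradiction refl n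
pairwise s r₁ r₂ r₃ {zero}           {suc zero}       n = r₁
pairwise s r₁ r₂ r₃ {zero}           {suc (suc zero)} n = r₂
pairwise s r₁ r₂ r₃ {suc zero}       {zero}           n = s r₁
pairwise s r₁ r₂ r₃ {suc zero}       {suc zero}       n = contradiction refl n
pairwise s r₁ r₂ r₃ {suc zero}       {suc (suc zero)} n = r₃
pairwise s r₁ r₂ r₃ {suc (suc zero)} {zero}           n = s r₂
pairwise s r₁ r₂ r₃ {suc (suc zero)} {suc zero}       n = s r₃
pairwise s r₁ r₂ r₃ {suc (suc zero)} {suc (suc zero)} n = contradiction refl n

does-decides : ∀ {P : Set} {b} (P? : Dec P) → (b ≡ true → P) → (P → b ≡ true) → b ≡ does P?
does-decides (yes p) _ g = g p
does-decides (no ¬p) f _ = Bool.¬-not (¬p ∘ f)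

-- Pigeonhole principle with capacities

length-split : ∀ {X : Set} {P : X → Set} (P? : Decidable P) xs →
               length (filter P? xs) + length (filter (¬? ∘ P?) xs) ≡ length xs
length-split P? []       = refl
length-split P? (x ∷ xs) with P? x
... | yes _ = cong suc (length-split P? xs)
... | no _  = trans (ℕ.+-suc _ _) (cong suc (length-split P? xs))

module Pigeonhole {X Box : Set} (_≟_ : DecidableEquality Box)
                  (f : X → Box) (capacity : Box → ℕ) where

  -- If the first box is not overfull, discarding its contents removes at most `capacity b`
  -- elements, and what remains is still too much for the other boxes. `Unique` is kept so that
  -- distinct elements can be picked from the result.
  overfull : ∀ boxes xs → Unique xs → (∀ {x} → x ∈ xs → f x ∈ boxes) →
             sum (map capacity boxes) < length xs →
             ∃[ b ] ∃[ ys ] (Unique ys × All (λ y → f y ≡ b) ys × capacity b < length ys)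
  overfull []      (x ∷ xs) _      placed _    with () ← placed (here refl)
  overfull (b ∷ bs) xs       unique placed many
    with capacity b <? length (filter (λ x → f x ≟ b) xs)
  ... | yes full = b , _ , filter⁺ (λ x → f x ≟ b) unique , all-filter (λ x → f x ≟ b) xs , full
  ... | no ¬full = overfull bs (filter (λ x → ¬? (f x ≟ b)) xs) (filter⁺ _ unique) placed′
      (ℕ.+-cancelˡ-< (capacity b) _ _ (ℕ.<-≤-trans many
        (ℕ.≤-trans (ℕ.≤-reflexive (sym (length-split (λ x → f x ≟ b) xs)))
          (ℕ.+-monoˡ-≤ _ (ℕ.≮⇒≥ ¬full)))))
    where
    placed′ : ∀ {x} → x ∈ filter (λ x → ¬? (f x ≟ b)) xs → f x ∈ bs
    placed′ x∈ with ∈-filter⁻ (λ x → ¬? (f x ≟ b)) x∈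
    ... | x∈xs , fx≢b with placed x∈xs
    ... | here fx≡b = contradiction fx≡b fx≢b
    ... | there fx∈ = fx∈

pick-two : ∀ {X : Set} {P : X → Set} {xs} → Unique xs → All P xs → 1 < length xs →
           ∃[ x ] ∃[ y ] (x ≢ y × P x × P y)
pick-two ((x≢y ∷ _) ∷ _) (px ∷ py ∷ _) _ = _ , _ , x≢y , px , py
pick-two {xs = _ ∷ []} _ _ (s≤s ())

pick-three : ∀ {X : Set} {P : X → Set} {xs} → Unique xs → All P xs → 2 < length xs →
             Σ (Fin 3 → X) λ h → (∀ {i j} → i ≢ j → h i ≢ h j) × (∀ i → P (h i))
pick-three {X} {P} {x ∷ y ∷ z ∷ _} ((x≢y ∷ x≢z ∷ _) ∷ (y≢z ∷ _) ∷ _) (px ∷ py ∷ pz ∷ _) _ =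
  h , pairwise {R = λ i j → h i ≢ h j} ≢-sym x≢y x≢z y≢z
    , λ { zero → px ; (suc zero) → py ; (suc (suc zero)) → pz }
  where
  h : Fin 3 → X
  h zero             = x
  h (suc zero)       = y
  h (suc (suc zero)) = z
pick-three {xs = _ ∷ []}     _ _ (s≤s ())
pick-three {xs = _ ∷ _ ∷ []} _ _ (s≤s (s≤s ()))

-- Induced paths from walks, and thetas from three walks

module InGraph (G : Graph) (simple : IsSimple G) where

  open IsSimple simple public using (irrefl) renaming (sym to adj-sym)

  V : Set
  V = Vertex G

  infix 4 _~_ _~?_

  _~_ : V → V → Set
  u ~ v = adj G u v ≡ true

  _~?_ : ∀ u v → Dec (u ~ v)
  u ~? v = adj G u v Bool.≟ true

  ~-sym : ∀ {u v} → u ~ v → v ~ u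
  ~-sym = trans (adj-sym _ _)

  ~-respˡ : ∀ {u v w} → u ≡ v → u ~ w → v ~ w
  ~-respˡ refl e = e

  ~-respʳ : ∀ {u v w} → u ≡ v → w ~ u → w ~ v
  ~-respʳ refl e = e

  ~⇒≢ : ∀ {u v} → u ~ v → u ≢ v
  ~⇒≢ e refl with () ← trans (sym (irrefl _)) e

  Apart : V → V → Set
  Apart u v = u ≢ v × ¬ u ~ v

  Apart-sym : ∀ {u v} → Apart u v → Apart v u
  Apart-sym (n , a) = ≢-sym n , a ∘ ~-sym

  open InducedPath

  suffix : ∀ {D u v} (P : InducedPath G D u v) {s} → s ≤ len P → InducedPath G D (at P s) v
  suffix P {s} s≤ = record
    { len      = len P ∸ s
    ; at       = λ i → at P (i + s)
    ; start    = refl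
    ; end      = trans (cong (at P) (ℕ.m∸n+n≡m s≤)) (end P)
    ; inside   = inside P ∘ shift
    ; step     = step P ∘ shift
    ; far      = λ i<j j≤ → far P (ℕ.+-monoˡ-< s i<j) (shift j≤)
    ; distinct = λ i<j j≤ → distinct P (ℕ.+-monoˡ-< s i<j) (shift j≤)
    }
    where
    shift : ∀ {i} → i ≤ len P ∸ s → i + s ≤ len P
    shift i≤ = subst (_ ≤_) (ℕ.m∸n+n≡m s≤) (ℕ.+-monoˡ-≤ s i≤)

  prepend : ∀ {D u v w} (P : InducedPath G D v w) → D u → u ~ v → u ≢ v →
           (∀ {j} → 0 < j → j ≤ len P → Apart u (at P j)) → InducedPath G D u w
  prepend {u = u} P d u~v u≢v away = record
    { len      = suc (len P)
    ; at       = λ { zero → u ; (suc i) → at P i }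
    ; start    = refl
    ; end      = end P
    ; inside   = λ { {zero} _ → d ; {suc i} i≤ → inside P (s≤s⁻¹ i≤) }
    ; step     = λ { {zero} _ → ~-respʳ (sym (start P)) u~v ; {suc i} i< → step P (s≤s⁻¹ i<) }
    ; far      = λ { {zero}  {suc j} (s≤s 0<j) j≤ → proj₂ (away 0<j (s≤s⁻¹ j≤))
                   ; {suc i} {suc j} (s≤s i<j) j≤ → far P i<j (s≤s⁻¹ j≤) }
    ; distinct = λ { {zero}  {suc zero}    _ _ e → u≢v (trans e (start P))
                   ; {zero}  {suc (suc j)} _ j≤ → proj₁ (away ℕ.0<1+n (s≤s⁻¹ j≤))
                   ; {suc i} {suc j} (s≤s i<j) j≤ → distinct P i<j (s≤s⁻¹ j≤) }
    }

  abstract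
    -- Shortcutting, by induction on the walk: in the induced path of the tail, keep what follows
    -- the last vertex equal or adjacent to `u`. If that vertex is `u`, this is the path; if not,
    -- `u` can be put in front, being apart from all later vertices.
    induce : ∀ {D u v} → Walk G D u v → InducedPath G D u v
    induce {u = u} [ d ] = record
      { len = 0 ; at = λ _ → u ; start = refl ; end = refl ; inside = λ _ → d
      ; step = λ () ; far = λ { () z≤n } ; distinct = λ { () z≤n } }
    induce {u = u} (d ∷⟨ e ⟩ p)
      with P ← induce p
      with s , s≤ , near , above ← last-index (λ i → (u Fin.≟ at P i) ⊎-dec (u ~? at P i)) (len P)
                                     (0 , z≤n , inj₂ (~-respʳ (sym (start P)) e))
      with near
    ... | inj₁ refl = suffix P s≤
    ... | inj₂ u~s  = prepend (suffix P s≤) d u~s (~⇒≢ u~s) λ {j} 0<j j≤ →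
      let far-out = above (ℕ.m<n+m s 0<j) (subst (j + s ≤_) (ℕ.m∸n+n≡m s≤) (ℕ.+-monoˡ-≤ s j≤))
      in far-out ∘ inj₁ , far-out ∘ inj₂

  HasTheta : Set
  HasTheta = ∃[ x ] ∃[ y ] ∃[ z ] (1 ≤ x × 1 ≤ y × 1 ≤ z × Theta x y z ⊑ᵢ G)

  module _ (ℓ : Fin 3 → ℕ) where

    open Slots ℓ

    -- Injectivity is stated on codes because a slot also contains a proof. Together `sound` and
    -- `complete` make adjacency in `G` agree with the decision of `Arc`, which is the Boolean
    -- formula of `Theta`.
    embed-theta : (g : Slot → V) → (∀ {s t} → g s ≡ g t → code s ≡ code t) →
                  (∀ s t → g s ~ g t → s ↦ t ⊎ t ↦ s) → (∀ {s t} → s ↦ t → g s ~ g t) → HasTheta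
    embed-theta g g-injective sound complete =
      _ , _ , _ , s≤s z≤n , s≤s z≤n , s≤s z≤n , f , f-injective , f-adj
      where
      slot : Fin (size (Theta (count zero) (count (suc zero)) (count (suc (suc zero))))) → Slot
      slot i = proj₁ (locate (toℕ i) (Fin.toℕ<n i))

      code-slot : ∀ i → code (slot i) ≡ toℕ i
      code-slot i = proj₂ (locate (toℕ i) (Fin.toℕ<n i))

      f : Fin _ → V
      f = g ∘ slot

      f-injective : Injective _≡_ _≡_ f
      f-injective {i} {j} e =
        Fin.toℕ-injective (trans (sym (code-slot i)) (trans (g-injective e) (code-slot j)))

      arcs? : ∀ u v → Dec (Arc u v ⊎ Arc v u)
      arcs? u v = arc? u v ⊎-dec arc? v u

      g-adj : ∀ s t → adj G (g s) (g t) ≡ does (arcs? (code s) (code t))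
      g-adj s t = does-decides (arcs? (code s) (code t)) (Sum.map ↦⇒arc ↦⇒arc ∘ sound s t)
        [ complete ∘ arc⇒↦ s t , ~-sym ∘ complete ∘ arc⇒↦ t s ]′

      f-adj : ∀ i j → adj G (f i) (f j) ≡ does (arcs? (toℕ i) (toℕ j))
      f-adj i j = trans (g-adj (slot i) (slot j))
                        (cong₂ (λ u v → does (arcs? u v)) (code-slot i) (code-slot j))

  -- Each walk is shortened to an induced path within its own region. Inner vertices of such a path
  -- differ from `c` and `d`, so separation of the regions off these two excludes all contacts
  -- between different paths.
  walks⇒theta : ∀ {c d} {E : Fin 3 → V → Set} → Apart c d → (∀ i → Walk G (E i) c d) →
                (∀ {i j u v} → i ≢ j → E i u → E j v → u ≢ c → u ≢ d → v ≢ c → v ≢ d → Apart u v) →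
                HasTheta
  walks⇒theta {c} {d} {E} (c≢d , c≁d) walk separated =
    embed-theta ℓ g (λ {s} {t} → g-injective {s} {t}) sound complete
    where
    P : ∀ i → InducedPath G (E i) c d
    P i = induce (walk i)

    -- Length 0 would identify `c` with `d`, and length 1 would make them adjacent.
    long : ∀ i → ∃[ n ] (len (P i) ≡ 2 + n)
    long i with len (P i) in e
    ... | zero          = contradiction (trans (sym (start (P i)))
                                          (trans (cong (at (P i)) (sym e)) (end (P i)))) c≢d
    ... | suc zero      = contradiction (subst₂ _~_ (start (P i))
                                          (trans (cong (at (P i)) (sym e)) (end (P i)))
                                          (step (P i) (subst (0 <_) (sym e) z<s))) c≁d
    ... | suc (suc n)   = n , refl

    ℓ : Fin 3 → ℕ
    ℓ i = proj₁ (long i)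

    open Slots ℓ

    g : Slot → V
    g source        = c
    g target        = d
    g (inner i m _) = at (P i) (suc m)

    bound : ∀ i {m} → m < count i → suc m < len (P i)
    bound i m< = subst (_ <_) (sym (proj₂ (long i))) (s<s m<)

    ends-at : ∀ i → at (P i) (2 + ℓ i) ≡ d
    ends-at i = trans (cong (at (P i)) (sym (proj₂ (long i)))) (end (P i))

    inner≢source : ∀ i {m} → m < count i → at (P i) (suc m) ≢ c
    inner≢source i m< e = distinct (P i) z<s (ℕ.<⇒≤ (bound i m<)) (trans (start (P i)) (sym e))

    inner≢target : ∀ i {m} → m < count i → at (P i) (suc m) ≢ d
    inner≢target i m< e = distinct (P i) (bound i m<) ℕ.≤-refl (trans e (sym (end (P i))))

    apart : ∀ {i j m n} → i ≢ j → m < count i → n < count j →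
            Apart (at (P i) (suc m)) (at (P j) (suc n))
    apart {i} {j} i≢j m< n< = separated i≢j
      (inside (P i) (ℕ.<⇒≤ (bound i m<))) (inside (P j) (ℕ.<⇒≤ (bound j n<)))
      (inner≢source i m<) (inner≢target i m<) (inner≢source j n<) (inner≢target j n<)

    g-injective : ∀ {s t} → g s ≡ g t → code s ≡ code t
    g-injective {source}       {source}       e = refl
    g-injective {source}       {target}       e = contradiction e c≢d
    g-injective {source}       {inner i m m<} e = contradiction (sym e) (inner≢source i m<)
    g-injective {target}       {source}       e = contradiction (sym e) c≢d
    g-injective {target}       {target}       e = refl
    g-injective {target}       {inner i m m<} e = contradiction (sym e) (inner≢target i m<)
    g-injective {inner i m m<} {source}       e = contradiction e (inner≢source i m<)
    g-injective {inner i m m<} {target}       e = contradiction e (inner≢target i m<)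
    g-injective {inner i m m<} {inner j n n<} e with i Fin.≟ j
    ... | no i≢j   = contradiction e (proj₁ (apart i≢j m< n<))
    ... | yes refl = cong (λ k → 2 + (off i + k))
                       (ℕ.suc-injective (at-injective (P i) (ℕ.<⇒≤ (bound i m<)) (ℕ.<⇒≤ (bound i n<)) e))

    sound-source : ∀ i {m} (m< : m < count i) → c ~ at (P i) (suc m) → source ↦ inner i m m<
    sound-source i {zero}  m< e = leave
    sound-source i {suc m} m< e =
      contradiction (~-respˡ (sym (start (P i))) e) (far (P i) (s<s z<s) (ℕ.<⇒≤ (bound i m<)))

    sound-target : ∀ i {m} (m< : m < count i) → at (P i) (suc m) ~ d → inner i m m< ↦ target
    sound-target i {m} m< e with ℕ.m≤n⇒m<n∨m≡n (s≤s⁻¹ m<)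
    ... | inj₂ refl = enter
    ... | inj₁ m<ℓ  = contradiction (~-respʳ (sym (ends-at i)) e)
                        (far (P i) (s<s (s<s m<ℓ)) (ℕ.≤-reflexive (sym (proj₂ (long i)))))

    sound-inner : ∀ i {m n} (m< : m < count i) (n< : n < count i) → m < n →
                  at (P i) (suc m) ~ at (P i) (suc n) → inner i m m< ↦ inner i n n<
    sound-inner i m< n< m<n e with ℕ.m≤n⇒m<n∨m≡n m<n
    ... | inj₂ refl = move
    ... | inj₁ sm<n = contradiction e (far (P i) (s<s sm<n) (ℕ.<⇒≤ (bound i n<)))

    sound : ∀ s t → g s ~ g t → s ↦ t ⊎ t ↦ s
    sound source         source         e = contradiction refl (~⇒≢ e)
    sound source         target         e = contradiction e c≁d
    sound source         (inner i m m<) e = inj₁ (sound-source i m< e)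
    sound target         source         e = contradiction (~-sym e) c≁d
    sound target         target         e = contradiction refl (~⇒≢ e)
    sound target         (inner i m m<) e = inj₂ (sound-target i m< (~-sym e))
    sound (inner i m m<) source         e = inj₂ (sound-source i m< (~-sym e))
    sound (inner i m m<) target         e = inj₁ (sound-target i m< e)
    sound (inner i m m<) (inner j n n<) e with i Fin.≟ j
    ... | no i≢j = contradiction e (proj₂ (apart i≢j m< n<))
    ... | yes refl with ℕ.<-cmp m n
    ... | tri< m<n _ _  = inj₁ (sound-inner i m< n< m<n e)
    ... | tri≈ _ refl _ = contradiction refl (~⇒≢ e)
    ... | tri> _ _ n<m  = inj₂ (sound-inner i n< m< n<m (~-sym e))

    complete : ∀ {s t} → s ↦ t → g s ~ g t
    complete (leave {i})           = ~-respˡ (start (P i)) (step (P i) (ℕ.<-trans z<s (bound i z<s)))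
    complete (move {i} {m} {q = q}) = step (P i) (ℕ.<-trans ℕ.≤-refl (bound i q))
    complete (enter {i})           = ~-respʳ (ends-at i) (step (P i) (bound i ℕ.≤-refl))

  -- Claws joining three vertices through a connected set

  TriangleFree : Set
  TriangleFree = ∀ {u v w} → u ~ v → v ~ w → ¬ u ~ w

  Connected : (V → Set) → Set
  Connected D = ∀ {u v} → D u → D v → Walk G D u v

  Touches : (V → Set) → V → Set
  Touches D z = ∃[ b ] (D b × z ~ b)

  -- An induced subdivided claw with ends `q i`, up to shortening its legs. The centre may itself be
  -- one of the `q i` and then lies on the legs of the others too, so `leg∈` speaks of the remaining
  -- vertices only.
  record Claw (B : V → Set) (q : Fin 3 → V) : Set₁ where
    field
      centre    : V
      leg       : Fin 3 → V → Set
      centre∈   : B centre ⊎ ∃[ i ] (centre ≡ q i)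
      leg∈      : ∀ i {z} → leg i z → z ≢ centre → B z ⊎ z ≡ q i
      walk      : ∀ i → Walk G (leg i) centre (q i)
      separated : ∀ {i j u v} → i ≢ j → leg i u → leg j v → u ≢ centre → v ≢ centre → Apart u v

  -- Take an induced path from q₀ to q₂ and walk from q₁ until its closed neighbourhood is hit,
  -- at t say.  The centre is t if t has two neighbours on the path (they are not consecutive, for
  -- want of triangles), and otherwise the vertex of the path that is equal or adjacent to t.
  module _ (triangle-free : TriangleFree) {B : V → Set} (q : Fin 3 → V)
           (spine : InducedPath G (λ z → B z ⊎ z ≡ q zero ⊎ z ≡ q (suc (suc zero)))
                                (q zero) (q (suc (suc zero)))) where

    private
      q₀ q₁ q₂ : V
      q₀ = q zero
      q₁ = q (suc zero)
      q₂ = q (suc (suc zero))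

    n : ℕ
    n = len spine

    p : ℕ → V
    p = at spine

    spine∈ : ∀ {m} → m ≤ n → m ≡ 0 ⊎ m ≡ n ⊎ B (p m)
    spine∈ m≤ with inside spine m≤
    ... | inj₁ b        = inj₂ (inj₂ b)
    ... | inj₂ (inj₁ e) = inj₁ (at-injective spine m≤ z≤n (trans e (sym (start spine))))
    ... | inj₂ (inj₂ e) = inj₂ (inj₁ (at-injective spine m≤ ℕ.≤-refl (trans e (sym (end spine)))))

    Part : ℕ → ℕ → V → Set
    Part i j z = ∃[ m ] (i ≤ m × m ≤ j × z ≡ p m)

    before : ∀ {s} → s ≤ n → Walk G (Part 0 s) (p s) q₀
    before s≤ = subst (Walk G _ _) (start spine) (reverseʷ simple (range spine z≤n s≤))

    after : ∀ {s} → s ≤ n → Walk G (Part s n) (p s) q₂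
    after s≤ = subst (Walk G _ _) (end spine) (range spine s≤ ℕ.≤-refl)

    -- The far end `q₂` occurs at position `n` only, hence not strictly before `s`.
    before∈ : ∀ {s m} → m < s → s ≤ n → B (p m) ⊎ p m ≡ q₀
    before∈ m<s s≤ with spine∈ (ℕ.<⇒≤ (ℕ.<-≤-trans m<s s≤))
    ... | inj₁ refl        = inj₂ (start spine)
    ... | inj₂ (inj₁ refl) = contradiction s≤ (ℕ.<⇒≱ m<s)
    ... | inj₂ (inj₂ b)    = inj₁ b

    after∈ : ∀ {s m} → s < m → m ≤ n → B (p m) ⊎ p m ≡ q₂
    after∈ s<m m≤ with spine∈ m≤
    ... | inj₁ refl        = contradiction s<m λ ()
    ... | inj₂ (inj₁ refl) = inj₂ (end spine)
    ... | inj₂ (inj₂ b)    = inj₁ b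

    spine-apart : ∀ {i j} → suc i < j → j ≤ n → Apart (p i) (p j)
    spine-apart i<j j≤ = distinct spine (ℕ.<-trans ℕ.≤-refl i<j) j≤ , far spine i<j j≤

    Hit : V → Set
    Hit z = ∃[ m ] (m < suc n × (z ≡ p m ⊎ z ~ p m))

    hit? : Decidable Hit
    hit? z = ℕ.anyUpTo? (λ m → (z Fin.≟ p m) ⊎-dec (z ~? p m)) (suc n)

    miss⇒apart : ∀ {z m} → ¬ Hit z → m ≤ n → Apart z (p m)
    miss⇒apart miss m≤ = (λ e → miss (_ , s≤s m≤ , inj₁ e)) , (λ e → miss (_ , s≤s m≤ , inj₂ e))

    Rib : V → Set
    Rib z = B z ⊎ z ≡ q₁

    -- Serves two cases: `t` lies on the spine, or it has exactly one neighbour there. The spine is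
    -- split at `p s` into two legs, and the third is whatever leads to `q₁`.
    centre-on-spine : ∀ {s} → s ≤ n → (leg₁ : V → Set) → Walk G leg₁ (p s) q₁ →
      (∀ {z} → leg₁ z → z ≢ p s → Rib z × (∀ {m} → m ≤ n → m ≢ s → Apart z (p m))) → Claw B q
    centre-on-spine {s} s≤ leg₁ walk₁ away = record
      { centre    = p s
      ; leg       = leg
      ; centre∈   = centre∈
      ; leg∈      = leg∈
      ; walk      = λ { zero → before s≤ ; (suc zero) → walk₁ ; (suc (suc zero)) → after s≤ }
      ; separated = λ i≢j → pairwise {R = Sep} (λ r u∈ v∈ u≢ v≢ → Apart-sym (r v∈ u∈ v≢ u≢))
                                 sep₀₁ sep₀₂ sep₁₂ i≢j
      }
      where
      leg : Fin 3 → V → Set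
      leg zero             = Part 0 s
      leg (suc zero)       = leg₁
      leg (suc (suc zero)) = Part s n

      centre∈ : B (p s) ⊎ ∃[ i ] (p s ≡ q i)
      centre∈ with inside spine s≤
      ... | inj₁ b        = inj₁ b
      ... | inj₂ (inj₁ e) = inj₂ (_ , e)
      ... | inj₂ (inj₂ e) = inj₂ (_ , e)

      leg∈ : ∀ i {z} → leg i z → z ≢ p s → B z ⊎ z ≡ q i
      leg∈ zero             (m , _ , m≤s , refl) ne = before∈ (ℕ.≤∧≢⇒< m≤s (ne ∘ cong p)) s≤
      leg∈ (suc zero)       l                    ne = proj₁ (away l ne)
      leg∈ (suc (suc zero)) (m , s≤m , m≤n , refl) ne = after∈ (ℕ.≤∧≢⇒< s≤m (ne ∘ cong p ∘ sym)) m≤n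

      Sep : Fin 3 → Fin 3 → Set
      Sep i j = ∀ {u v} → leg i u → leg j v → u ≢ p s → v ≢ p s → Apart u v

      sep₀₁ : Sep zero (suc zero)
      sep₀₁ (m , _ , m≤s , refl) l u≢ v≢ = Apart-sym (proj₂ (away l v≢) (ℕ.≤-trans m≤s s≤) (u≢ ∘ cong p))

      sep₀₂ : Sep zero (suc (suc zero))
      sep₀₂ (m , _ , m≤s , refl) (k , s≤k , k≤n , refl) u≢ v≢ =
        spine-apart (ℕ.<-≤-trans (s≤s (ℕ.≤∧≢⇒< m≤s (u≢ ∘ cong p))) (ℕ.≤∧≢⇒< s≤k (v≢ ∘ cong p ∘ sym))) k≤n

      sep₁₂ : Sep (suc zero) (suc (suc zero))
      sep₁₂ l (k , s≤k , k≤n , refl) u≢ v≢ = proj₂ (away l u≢) k≤n (v≢ ∘ cong p)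

    claw-at : ∀ {t} → Hit t → Walk G (λ z → Rib z × (Hit z → z ≡ t)) q₁ t → Claw B q
    claw-at {t} hit rib with ℕ.anyUpTo? (λ m → t Fin.≟ p m) (suc n)
    ... | yes (s , s< , refl) =
      centre-on-spine (s≤s⁻¹ s<) _ (reverseʷ simple rib)
        λ (r , only) z≢ → r , λ m≤ _ → miss⇒apart (z≢ ∘ only) m≤
    ... | no off with hit
    ... | m , m< , inj₁ e = contradiction (m , m< , e) off
    ... | m , m< , inj₂ e
      with s , s≤ , t~s , below ← first-index (λ i → t ~? p i) n (m , s≤s⁻¹ m< , e)
      with s′ , s′≤ , t~s′ , above ← last-index (λ i → t ~? p i) n (m , s≤s⁻¹ m< , e)
      with ℕ.<-cmp s s′
    ... | tri> _ _ s′<s = contradiction t~s (above s′<s s≤)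
    -- Here `p s` is the only neighbour of `t` on the spine: it becomes the centre, and `t` comes
    -- next to it on the middle leg.
    ... | tri≈ _ refl _ =
      centre-on-spine s≤ (λ z → z ≡ p s ⊎ (Rib z × (Hit z → z ≡ t)))
        (inj₁ refl ∷⟨ ~-sym t~s ⟩ mapʷ inj₂ (reverseʷ simple rib)) away
      where
      t≁ : ∀ {k} → k ≤ n → k ≢ s → ¬ t ~ p k
      t≁ {k} k≤ k≢s with ℕ.<-cmp k s
      ... | tri< k<s _ _ = below k<s
      ... | tri≈ _ k≡s _ = contradiction k≡s k≢s
      ... | tri> _ _ s<k = above s<k k≤

      away : ∀ {z} → z ≡ p s ⊎ (Rib z × (Hit z → z ≡ t)) → z ≢ p s →
             Rib z × (∀ {k} → k ≤ n → k ≢ s → Apart z (p k))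
      away (inj₁ z≡) z≢ = contradiction z≡ z≢
      away {z} (inj₂ (r , only)) z≢ with z Fin.≟ t
      ... | no z≢t   = r , λ k≤ _ → miss⇒apart (z≢t ∘ only) k≤
      ... | yes refl = r , λ k≤ k≢s → (λ e → off (_ , s≤s k≤ , e)) , t≁ k≤ k≢s
    -- The centre is `t`. The outer legs leave it through its first and its last neighbour on the
    -- spine, and the stretch strictly between these is dropped.
    ... | tri< s<s′ _ _ = record
      { centre    = t
      ; leg       = leg
      ; centre∈   = Sum.map₂ (_ ,_) (proj₁ (last∈ rib))
      ; leg∈      = leg∈
      ; walk      = λ { zero → inj₁ refl ∷⟨ t~s ⟩ mapʷ inj₂ (before s≤)
                      ; (suc zero) → reverseʷ simple rib
                      ; (suc (suc zero)) → inj₁ refl ∷⟨ t~s′ ⟩ mapʷ inj₂ (after s′≤) }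
      ; separated = λ i≢j → pairwise {R = Sep} (λ r u∈ v∈ u≢ v≢ → Apart-sym (r v∈ u∈ v≢ u≢))
                                 sep₀₁ sep₀₂ sep₁₂ i≢j
      }
      where
      leg : Fin 3 → V → Set
      leg zero             z = z ≡ t ⊎ Part 0 s z
      leg (suc zero)       z = Rib z × (Hit z → z ≡ t)
      leg (suc (suc zero)) z = z ≡ t ⊎ Part s′ n z

      leg∈ : ∀ i {z} → leg i z → z ≢ t → B z ⊎ z ≡ q i
      leg∈ zero             (inj₁ e)                      ne = contradiction e ne
      leg∈ zero             (inj₂ (m , _ , m≤s , refl))   ne = before∈ (ℕ.≤-<-trans m≤s s<s′) s′≤
      leg∈ (suc zero)       (r , _)                       ne = r
      leg∈ (suc (suc zero)) (inj₁ e)                      ne = contradiction e ne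
      leg∈ (suc (suc zero)) (inj₂ (m , s′≤m , m≤n , refl)) ne = after∈ (ℕ.<-≤-trans s<s′ s′≤m) m≤n

      s+1<s′ : suc s < s′
      s+1<s′ with ℕ.m≤n⇒m<n∨m≡n s<s′
      ... | inj₁ lt   = lt
      ... | inj₂ refl = contradiction t~s′ (triangle-free t~s (step spine s′≤))

      Sep : Fin 3 → Fin 3 → Set
      Sep i j = ∀ {u v} → leg i u → leg j v → u ≢ t → v ≢ t → Apart u v

      sep₀₁ : Sep zero (suc zero)
      sep₀₁ (inj₁ e)                     _          u≢ v≢ = contradiction e u≢
      sep₀₁ (inj₂ (m , _ , m≤s , refl)) (_ , only) u≢ v≢ =
        Apart-sym (miss⇒apart (v≢ ∘ only) (ℕ.≤-trans m≤s s≤))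

      sep₀₂ : Sep zero (suc (suc zero))
      sep₀₂ (inj₁ e) _ u≢ v≢ = contradiction e u≢
      sep₀₂ _ (inj₁ e) u≢ v≢ = contradiction e v≢
      sep₀₂ (inj₂ (m , _ , m≤s , refl)) (inj₂ (k , s′≤k , k≤n , refl)) u≢ v≢ =
        spine-apart (ℕ.≤-<-trans (s≤s m≤s) (ℕ.<-≤-trans s+1<s′ s′≤k)) k≤n

      sep₁₂ : Sep (suc zero) (suc (suc zero))
      sep₁₂ _          (inj₁ e)                     u≢ v≢ = contradiction e v≢
      sep₁₂ (_ , only) (inj₂ (k , _ , k≤n , refl)) u≢ v≢ = miss⇒apart (u≢ ∘ only) k≤n

  abstract
    claw : TriangleFree → ∀ {B q} → Connected B → (∀ i → Touches B (q i)) → Claw B q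
    claw triangle-free {q = q} connected touch =
      let _ , Bb₀ , e₀ = touch zero
          _ , Bb₁ , e₁ = touch (suc zero)
          _ , Bb₂ , e₂ = touch (suc (suc zero))
          spine = induce (inj₂ (inj₁ refl) ∷⟨ e₀ ⟩
                    snoc (mapʷ inj₁ (connected Bb₀ Bb₂)) (~-sym e₂) (inj₂ (inj₂ refl)))
          -- The walk from `q (suc zero)` ends at a neighbour of `q zero`, which is position 0 of
          -- the spine, so a hit is guaranteed.
          _ , hit , rib = first-hit (hit? triangle-free q spine)
                            (inj₂ refl ∷⟨ e₁ ⟩ mapʷ inj₁ (connected Bb₁ Bb₀))
                            (0 , z<s , inj₂ (~-respʳ (sym (start spine)) (~-sym e₀)))
      in claw-at triangle-free q spine hit rib

  -- A theta from three long links

  Anticomplete : (V → Set) → (V → Set) → Set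
  Anticomplete X Y = ∀ {u v} → X u → Y v → Apart u v

  -- By `only` and `only′` the link meets `B` and `B′` through its ends alone. With `apart`, the
  -- centres of the two claws stay apart even when they are the ends of one link.
  record LongLink (A B B′ : V → Set) : Set₁ where
    field
      Q       : V → Set
      Q⊆A     : ∀ {z} → Q z → A z
      q q′    : V
      walk    : Walk G Q q q′
      touch   : Touches B q
      touch′  : Touches B′ q′
      only    : ∀ {z} → Q z → Touches B z → z ≡ q
      only′   : ∀ {z} → Q z → Touches B′ z → z ≡ q′
      apart   : Apart q q′

  flip : ∀ {A B B′} → LongLink A B B′ → LongLink A B′ B
  flip L = record
    { Q = Q ; Q⊆A = Q⊆A ; q = q′ ; q′ = q ; walk = reverseʷ simple walk ; touch = touch′ ; touch′ = touch
    ; only = only′ ; only′ = only ; apart = Apart-sym apart }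
    where open LongLink L

  module _ (triangle-free : TriangleFree) {A : Fin 3 → V → Set} {B B′ : V → Set}
           (connected : Connected B) (connected′ : Connected B′) (BB′ : Anticomplete B B′)
           (AA : ∀ {i j} → i ≢ j → Anticomplete (A i) (A j))
           (AB : ∀ {i v} → A i v → ¬ B v) (AB′ : ∀ {i v} → A i v → ¬ B′ v)
           (link : ∀ i → LongLink (A i) B B′) where

    open LongLink

    private
      q∈ : ∀ i → A i (q (link i))
      q∈ i = Q⊆A (link i) (first∈ (walk (link i)))

      q′∈ : ∀ i → A i (q′ (link i))
      q′∈ i = Q⊆A (link i) (last∈ (walk (link i)))

      hub : Claw B (λ i → q (link i))
      hub = claw triangle-free connected (λ i → touch (link i))

      hub′ : Claw B′ (λ i → q′ (link i))
      hub′ = claw triangle-free connected′ (λ i → touch′ (link i))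

      open Claw

      -- A vertex of `Q (L j)` adjacent to a leg vertex in `B` touches `B`, hence is the end
      -- `q (L j)`; but that end lies on leg `j`, which is separated from leg `i`. The bags are
      -- arguments so that flipped links and the second claw are covered too.
      leg-Q : ∀ {B B′} (L : ∀ i → LongLink (A i) B B′) (hub : Claw B (λ i → q (L i))) →
              (∀ {i v} → A i v → ¬ B v) → ∀ {i j u v} → i ≢ j → leg hub i u → Q (L j) v →
              u ≢ centre hub → v ≢ centre hub → Apart u v
      leg-Q L hub AB {i} {j} i≢j l m u≢ v≢ with leg∈ hub i l u≢
      ... | inj₂ refl = AA i≢j (Q⊆A (L i) (first∈ (walk (L i)))) (Q⊆A (L j) m)
      ... | inj₁ b    = (λ { refl → AB (Q⊆A (L j) m) b }) , λ u~v →
        case only (L j) m (_ , b , ~-sym u~v) of λ where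
          refl → proj₂ (separated hub i≢j l (last∈ (walk hub j)) u≢ v≢) u~v

      -- An end `q′` with a neighbour in `B` would equal the end `q` of its link, against `apart`;
      -- likewise with the sides exchanged. What `ij` settles is two ends of the same link.
      hub-hub : ∀ {i j u v} → (i ≡ j → Apart (q (link i)) (q′ (link j))) →
                B u ⊎ u ≡ q (link i) → B′ v ⊎ v ≡ q′ (link j) → Apart u v
      hub-hub ij (inj₁ b) (inj₁ b′) = BB′ b b′
      hub-hub {i} {j} ij (inj₁ b) (inj₂ refl) = (λ { refl → AB (q′∈ j) b }) , λ u~v →
        proj₁ (apart (link j)) (sym (only (link j) (last∈ (walk (link j))) (_ , b , ~-sym u~v)))
      hub-hub {i} {j} ij (inj₂ refl) (inj₁ b′) = (λ { refl → AB′ (q∈ i) b′ }) , λ u~v →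
        proj₁ (apart (link i)) (only′ (link i) (first∈ (walk (link i))) (_ , b′ , u~v))
      hub-hub {i} {j} ij (inj₂ refl) (inj₂ refl) with i Fin.≟ j
      ... | yes e  = ij e
      ... | no i≢j = AA i≢j (q∈ i) (q′∈ j)

      centres-apart : Apart (centre hub) (centre hub′)
      centres-apart with centre∈ hub | centre∈ hub′
      -- A centre inside `B` or `B′` prescribes no link: the index is copied from the other centre,
      -- or is zero if neither prescribes one.
      ... | inj₁ b       | inj₁ b′      = hub-hub {zero} {zero} (λ _ → apart (link zero)) (inj₁ b) (inj₁ b′)
      ... | inj₁ b       | inj₂ (j , e) = hub-hub {j} {j} (λ _ → apart (link j)) (inj₁ b) (inj₂ e)
      ... | inj₂ (i , e) | inj₁ b′      = hub-hub {i} {i} (λ _ → apart (link i)) (inj₂ e) (inj₁ b′)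
      ... | inj₂ (i , e) | inj₂ (j , f) = hub-hub {i} {j} (λ { refl → apart (link i) }) (inj₂ e) (inj₂ f)

    -- Path `i` runs along leg `i` of the first claw, through link `i`, and back along leg `i` of
    -- the second claw.
    links⇒theta : HasTheta
    links⇒theta = walks⇒theta {E = E} centres-apart
      (λ i → mapʷ inj₁ (walk hub i) ++ʷ mapʷ (inj₂ ∘ inj₁) (walk (link i))
             ++ʷ mapʷ (inj₂ ∘ inj₂) (reverseʷ simple (walk hub′ i)))
      sep
      where
      E : Fin 3 → V → Set
      E i z = leg hub i z ⊎ Q (link i) z ⊎ leg hub′ i z

      leg-leg : ∀ {i j u v} → i ≢ j → leg hub i u → leg hub′ j v →
                u ≢ centre hub → v ≢ centre hub′ → Apart u v
      leg-leg i≢j l l′ u≢ v≢ =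
        hub-hub (λ i≡j → contradiction i≡j i≢j) (leg∈ hub _ l u≢) (leg∈ hub′ _ l′ v≢)

      sep : ∀ {i j u v} → i ≢ j → E i u → E j v →
            u ≢ centre hub → u ≢ centre hub′ → v ≢ centre hub → v ≢ centre hub′ → Apart u v
      sep ne (inj₁ l)        (inj₁ m)        u≢ u≢′ v≢ v≢′ = separated hub ne l m u≢ v≢
      sep ne (inj₁ l)        (inj₂ (inj₁ m)) u≢ u≢′ v≢ v≢′ = leg-Q link hub AB ne l m u≢ v≢
      sep ne (inj₁ l)        (inj₂ (inj₂ m)) u≢ u≢′ v≢ v≢′ = leg-leg ne l m u≢ v≢′
      sep ne (inj₂ (inj₁ l)) (inj₁ m)        u≢ u≢′ v≢ v≢′ =
        Apart-sym (leg-Q link hub AB (≢-sym ne) m l v≢ u≢)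
      sep ne (inj₂ (inj₁ l)) (inj₂ (inj₁ m)) u≢ u≢′ v≢ v≢′ = AA ne (Q⊆A (link _) l) (Q⊆A (link _) m)
      sep ne (inj₂ (inj₁ l)) (inj₂ (inj₂ m)) u≢ u≢′ v≢ v≢′ =
        Apart-sym (leg-Q (flip ∘ link) hub′ AB′ (≢-sym ne) m l v≢′ u≢′)
      sep ne (inj₂ (inj₂ l)) (inj₁ m)        u≢ u≢′ v≢ v≢′ = Apart-sym (leg-leg (≢-sym ne) m l v≢ u≢′)
      sep ne (inj₂ (inj₂ l)) (inj₂ (inj₁ m)) u≢ u≢′ v≢ v≢′ = leg-Q (flip ∘ link) hub′ AB′ ne l m u≢′ v≢′
      sep ne (inj₂ (inj₂ l)) (inj₂ (inj₂ m)) u≢ u≢′ v≢ v≢′ = separated hub′ ne l m u≢′ v≢′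

  -- Growth inside a bag: a long link or a cover

  SomeLongLink : ∀ {m} → (V → Set) → (Fin m → V → Set) → Set₁
  SomeLongLink A B = ∃[ j ] ∃[ k ] (j ≢ k × LongLink A (B j) (B k))

  EdgeCover : ∀ {m} → (V → Set) → (Fin m → V → Set) → Set
  EdgeCover A B = ∃[ x ] ∃[ y ] (A x × A y × (∀ j → Touches (B j) x ⊎ Touches (B j) y))

  module _ (triangle-free : TriangleFree) {m : ℕ} {A : V → Set} {B : Fin m → V → Set}
           (B? : ∀ j → Decidable (B j)) where

    private
      touches? : ∀ j → Decidable (Touches (B j))
      touches? j z = Fin.any? (λ b → B? j b ×-dec (z ~? b))

    -- The state of the growth. Connectedness is kept as walks from the root `r`. The invariant is
    -- `cover`: whatever `S` touches is touched by `x` or `y`, which form a vertex or an edge by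
    -- `close`.
    record Grown (r : V) : Set₁ where
      field
        S     : V → Set
        S⊆A   : ∀ {z} → S z → A z
        reach : ∀ {z} → S z → Walk G S r z
        x y   : V
        x∈S   : S x
        y∈S   : S y
        close : x ≡ y ⊎ x ~ y
        cover : ∀ {z j} → S z → Touches (B j) z → Touches (B j) x ⊎ Touches (B j) y

    open Grown

    -- A way from `v` to `x` and to `y` that enters `R` at the only neighbour `w` of `v` in it. This
    -- uniqueness will make the ends of a long link nonadjacent.
    record Approach (S : V → Set) (v x y : V) : Set₁ where
      field
        R    : V → Set
        R⊆S  : ∀ {z} → R z → S z
        w    : V
        w~v  : w ~ v
        to-x : Walk G R w x
        to-y : Walk G R w y
        only : ∀ {z} → R z → z ~ v → z ≡ w

    -- If `y` is adjacent to `v`, take `w = y`; then `x` is equal to `y` or, for want of triangles,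
    -- not adjacent to `v`. If not, follow `S` from `x` to the first neighbour of `v`, possibly `x`
    -- itself; adding `y` to `R` brings no further neighbour of `v`.
    approach : ∀ {r u v} (g : Grown r) → S g u → u ~ v → Approach (S g) v (x g) (y g)
    approach {v = v} g Su u~v with y g ~? v
    ... | yes y~v = record
      { R = λ z → z ≡ y g ⊎ z ≡ x g ; R⊆S = λ { (inj₁ refl) → y∈S g ; (inj₂ refl) → x∈S g }
      ; w = y g ; w~v = y~v ; to-x = to-x ; to-y = [ inj₁ refl ] ; only = only }
      where
      to-x : Walk G (λ z → z ≡ y g ⊎ z ≡ x g) (y g) (x g)
      to-x with close g
      ... | inj₁ x≡y = [ inj₁ refl ] ++ʷ subst (Walk G _ (y g)) (sym x≡y) [ inj₁ refl ]
      ... | inj₂ x~y = inj₁ refl ∷⟨ ~-sym x~y ⟩ [ inj₂ refl ]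
      only : ∀ {z} → z ≡ y g ⊎ z ≡ x g → z ~ v → z ≡ y g
      only (inj₁ e) _ = e
      only (inj₂ refl) x~v with close g
      ... | inj₁ x≡y = x≡y
      ... | inj₂ x~y = contradiction x~v (triangle-free x~y y~v)
    ... | no y≁v
      with w , w~v , p ← first-hit (λ z → z ~? v)
                           (reverseʷ simple (reach g (x∈S g)) ++ʷ reach g Su) u~v = record
      { R = R ; R⊆S = λ { (inj₁ (s , _)) → s ; (inj₂ refl) → y∈S g }
      ; w = w ; w~v = w~v ; to-x = back ; to-y = to-y
      ; only = λ { (inj₁ (_ , o)) → o ; (inj₂ refl) y~v → contradiction y~v y≁v } }
      where
      R : V → Set
      R z = (S g z × (z ~ v → z ≡ w)) ⊎ z ≡ y g
      back : Walk G R w (x g)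
      back = mapʷ inj₁ (reverseʷ simple p)
      to-y : Walk G R w (y g)
      to-y with close g
      ... | inj₁ x≡y = subst (Walk G R w) x≡y back
      ... | inj₂ x~y = snoc back x~y (inj₂ refl)

    -- If v is the first to touch B k, then for every B j touched by x or y but neither by v nor by
    -- its neighbour w, the walk from w to the first toucher of B j gives, with v, a long link.
    -- If there is no such B j, the edge wv takes over from x and y.
    grow : ∀ {r u v} (g : Grown r) → S g u → A v → u ~ v →
           SomeLongLink A B ⊎ Σ (Grown r) λ g′ → (∀ {z} → S g z → S g′ z) × S g′ v
    grow {r} {u} {v} g Su Av u~v = go
      where
      S′ : V → Set
      S′ z = S g z ⊎ z ≡ v

      S′⊆A : ∀ {z} → S′ z → A z
      S′⊆A (inj₁ s)    = S⊆A g s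
      S′⊆A (inj₂ refl) = Av

      reach′ : ∀ {z} → S′ z → Walk G S′ r z
      reach′ (inj₁ s)    = mapʷ inj₁ (reach g s)
      reach′ (inj₂ refl) = snoc (mapʷ inj₁ (reach g Su)) u~v (inj₂ refl)

      go : SomeLongLink A B ⊎ Σ (Grown r) λ g′ → (∀ {z} → S g z → S g′ z) × S g′ v
      go with Fin.any? (λ k → touches? k v ×-dec ¬? (touches? k (x g)) ×-dec ¬? (touches? k (y g)))
      -- Here `v` touches only what `x` or `y` touches already, so the pair is kept.
      ... | no none = inj₂ (record
        { S = S′ ; S⊆A = S′⊆A ; reach = reach′ ; x = x g ; y = y g
        ; x∈S = inj₁ (x∈S g) ; y∈S = inj₁ (y∈S g) ; close = close g ; cover = cover′ }
        , inj₁ , inj₂ refl)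
        where
        cover′ : ∀ {z j} → S′ z → Touches (B j) z → Touches (B j) (x g) ⊎ Touches (B j) (y g)
        cover′ (inj₁ s) t = cover g s t
        cover′ {j = j} (inj₂ refl) t with touches? j (x g) | touches? j (y g)
        ... | yes tx | _      = inj₁ tx
        ... | no _   | yes ty = inj₂ ty
        ... | no ¬tx | no ¬ty = contradiction (j , t , ¬tx , ¬ty) none
      ... | yes (k , vk , ¬xk , ¬yk)
        with Fin.any? (λ j → (touches? j (x g) ⊎-dec touches? j (y g))
                             ×-dec ¬? (touches? j (Approach.w (approach g Su u~v)))
                             ×-dec ¬? (touches? j v))
      ... | yes (j , t , ¬wj , ¬vj) = inj₁ (j , k , (λ { refl → ¬vj vk }) , long t)
        where
        open Approach (approach g Su u~v)

        untouched : ∀ {z} → S g z → ¬ Touches (B k) z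
        untouched s tz = [ ¬xk , ¬yk ]′ (cover g s tz)

        from : ∀ {e} → Walk G R w e → Touches (B j) e → LongLink A (B j) (B k)
        from p te with z , tz , p′ ← first-hit (touches? j) p te = record
          { Q = Q
          ; Q⊆A = λ { (inj₁ (ρ , _)) → S⊆A g (R⊆S ρ) ; (inj₂ refl) → Av }
          ; q = z ; q′ = v
          ; walk = snoc (mapʷ inj₁ (reverseʷ simple p′)) w~v (inj₂ refl)
          ; touch = tz ; touch′ = vk
          ; only = λ { (inj₁ (_ , o)) → o ; (inj₂ refl) t → contradiction t ¬vj }
          ; only′ = λ { (inj₁ (ρ , _)) t → contradiction t (untouched (R⊆S ρ)) ; (inj₂ e) _ → e }
          -- If `z` were adjacent to `v`, it would be `w`; but `z` touches `B j` and `w` does not.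
          ; apart = (λ { refl → ¬vj tz })
                  , λ z~v → ¬wj (subst (Touches (B j)) (only (proj₁ (last∈ p′)) z~v) tz)
          }
          where
          Q : V → Set
          Q ζ = (R ζ × (Touches (B j) ζ → ζ ≡ z)) ⊎ ζ ≡ v

        long : Touches (B j) (x g) ⊎ Touches (B j) (y g) → LongLink A (B j) (B k)
        long = [ from to-x , from to-y ]′
      ... | no none = inj₂ (record
        { S = S′ ; S⊆A = S′⊆A ; reach = reach′ ; x = w ; y = v
        ; x∈S = inj₁ (R⊆S (first∈ to-x)) ; y∈S = inj₂ refl ; close = inj₂ w~v ; cover = cover′ }
        , inj₁ , inj₂ refl)
        where
        open Approach (approach g Su u~v)

        cover′ : ∀ {z j} → S′ z → Touches (B j) z → Touches (B j) w ⊎ Touches (B j) v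
        cover′ (inj₂ refl) t = inj₂ t
        cover′ {j = j} (inj₁ s) t with touches? j w | touches? j v
        ... | yes tw | _      = inj₁ tw
        ... | no _   | yes tv = inj₂ tv
        ... | no ¬tw | no ¬tv = contradiction (j , cover g s t , ¬tw , ¬tv) none

    grow-along : ∀ {r u v} → Walk G A u v → (g : Grown r) → S g u →
                 SomeLongLink A B ⊎ Σ (Grown r) λ g′ → (∀ {z} → S g z → S g′ z) × S g′ v
    grow-along [ _ ]          g Su = inj₂ (g , id , Su)
    grow-along (_ ∷⟨ e ⟩ p) g Su with grow g Su (first∈ p) e
    ... | inj₁ L = inj₁ L
    ... | inj₂ (g₁ , sub₁ , Sw) with grow-along p g₁ Sw
    ... | inj₁ L = inj₁ L
    ... | inj₂ (g₂ , sub₂ , Sv) = inj₂ (g₂ , sub₂ ∘ sub₁ , Sv)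

    -- Start from the root alone and, for each `j` in turn, grow along a walk in `A` from `r` to a
    -- vertex touching `B j`. What has been met stays met because the set only grows; at the end
    -- `cover` applies to every `j`.
    link-or-cover : ∀ {r} → A r → Connected A → (∀ j → ∃[ s ] (A s × Touches (B j) s)) →
                    SomeLongLink A B ⊎ EdgeCover A B
    link-or-cover {r} Ar connected touch = Sum.map₂ covering (visit (allFin m))
      where
      Met : Grown r → Fin m → Set
      Met g j = ∃[ s ] (S g s × Touches (B j) s)

      singleton : Grown r
      singleton = record
        { S = _≡ r ; S⊆A = λ { refl → Ar } ; reach = λ { refl → [ refl ] } ; x = r ; y = r
        ; x∈S = refl ; y∈S = refl ; close = inj₁ refl ; cover = λ { refl → inj₁ } }

      visit : ∀ js → SomeLongLink A B ⊎ Σ (Grown r) λ g → S g r × All (Met g) js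
      visit [] = inj₂ (singleton , refl , [])
      visit (j ∷ js) with visit js
      ... | inj₁ L = inj₁ L
      ... | inj₂ (g , Sr , met) with s , As , t ← touch j with grow-along (connected Ar As) g Sr
      ... | inj₁ L = inj₁ L
      ... | inj₂ (g′ , sub , Ss) =
        inj₂ (g′ , sub Sr , (s , Ss , t) ∷ All.map (λ (z , Sz , tz) → z , sub Sz , tz) met)

      covering : (Σ (Grown r) λ g → S g r × All (Met g) (allFin m)) → EdgeCover A B
      covering (g , _ , met) = x g , y g , S⊆A g (x∈S g) , S⊆A g (y∈S g) , λ j →
        let _ , Ss , t = All.lookup met (∈-allFin j) in cover g Ss t

  -- A theta from two covers

  covers⇒theta : ∀ {m} {A A′ : V → Set} {B : Fin m → V → Set} → 8 < m → Anticomplete A A′ →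
                 (∀ j → Connected (B j)) → (∀ {j k} → j ≢ k → Anticomplete (B j) (B k)) →
                 EdgeCover A B → EdgeCover A′ B → HasTheta
  covers⇒theta {m} {A} {A′} {B} 8<m AA′ connected BB
    (x , y , Ax , Ay , cover) (x′ , y′ , Ax′ , Ay′ , cover′) =
    conclude (overfull boxes (allFin m) (allFin⁺ m) (λ _ → boxed _)
               (subst (8 <_) (sym (length-tabulate {n = m} id)) 8<m))
    where
    is-left : ∀ {P Q : Set} → P ⊎ Q → Bool
    is-left (inj₁ _) = true
    is-left (inj₂ _) = false

    colour : Fin m → Bool × Bool
    colour j = is-left (cover j) , is-left (cover′ j)

    -- Capacity 2 makes an overfull box contain three indices. The four colours have total capacity
    -- 8, whence the bound on `m`.
    open Pigeonhole (Product.≡-dec Bool._≟_ Bool._≟_) colour (λ _ → 2)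

    boxes : List (Bool × Bool)
    boxes = cartesianProduct (true ∷ false ∷ []) (true ∷ false ∷ [])

    boxed : ∀ b → b ∈ boxes
    boxed (b , c) = ∈-cartesianProduct⁺ (bool b) (bool c)
      where
      bool : ∀ b → b ∈ true ∷ false ∷ []
      bool true  = here refl
      bool false = there (here refl)

    chosen : ∀ (D : V → Set) {x y} b → D x → D y → D (if b then x else y)
    chosen D true  Dx Dy = Dx
    chosen D false Dx Dy = Dy

    touched : ∀ {b x y} {D : V → Set} (c : Touches D x ⊎ Touches D y) →
              is-left c ≡ b → Touches D (if b then x else y)
    touched (inj₁ t) refl = t
    touched (inj₂ t) refl = t

    conclude : ∃[ b ] ∃[ js ] (Unique js × All (λ j → colour j ≡ b) js × 2 < length js) → HasTheta
    conclude ((b , b′) , js , unique , same , many)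
      with h , distinct , coloured ← pick-three unique same many =
      walks⇒theta {c} {d} {E} (AA′ (chosen A b Ax Ay) (chosen A′ b′ Ax′ Ay′)) walk separated
      where
      c d : V
      c = if b then x else y
      d = if b′ then x′ else y′

      -- Path `i` goes from `c` through `B (h i)` to `d`: the common colour fixes which ends touch
      -- all three bags.
      E : Fin 3 → V → Set
      E i z = z ≡ c ⊎ z ≡ d ⊎ B (h i) z

      walk : ∀ i → Walk G (E i) c d
      walk i with _ , Bu , c~u ← touched (cover (h i)) (cong proj₁ (coloured i))
                | _ , Bv , d~v ← touched (cover′ (h i)) (cong proj₂ (coloured i)) =
        inj₁ refl ∷⟨ c~u ⟩
          snoc (mapʷ (inj₂ ∘ inj₂) (connected (h i) Bu Bv)) (~-sym d~v) (inj₂ (inj₁ refl))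

      separated : ∀ {i j u v} → i ≢ j → E i u → E j v → u ≢ c → u ≢ d → v ≢ c → v ≢ d → Apart u v
      separated ne (inj₂ (inj₂ Bu)) (inj₂ (inj₂ Bv)) _ _ _ _ = BB (distinct ne) Bu Bv
      separated ne (inj₁ e)         _        u≢c _ _ _ = contradiction e u≢c
      separated ne (inj₂ (inj₁ e))  _        _ u≢d _ _ = contradiction e u≢d
      separated ne _ (inj₁ e)        _ _ v≢c _ = contradiction e v≢c
      separated ne _ (inj₂ (inj₁ e)) _ _ _ v≢d = contradiction e v≢d

  -- Triangles as induced cycles

  triangle : ∀ {u v w} → u ~ v → v ~ w → u ~ w → C 3 ⊑ᵢ G
  triangle {u} {v} {w} uv vw uw = f , injective , f-adj
    where
    f : Fin 3 → V
    f zero             = u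
    f (suc zero)       = v
    f (suc (suc zero)) = w

    f-~ : ∀ {i j} → i ≢ j → f i ~ f j
    f-~ = pairwise {R = λ i j → f i ~ f j} ~-sym uv uw vw

    injective : Injective _≡_ _≡_ f
    injective {i} {j} e with i Fin.≟ j
    ... | yes i≡j = i≡j
    ... | no i≢j  = contradiction e (~⇒≢ (f-~ i≢j))

    C₃-complete : ∀ {i j} → i ≢ j → adj (C 3) i j ≡ true
    C₃-complete = pairwise {R = λ i j → adj (C 3) i j ≡ true}
                           (λ {i} {j} → trans (Bool.∨-comm (toℕ i ≡ᵇ _) _)) refl refl refl

    C₃-irrefl : ∀ i → adj (C 3) i i ≡ false
    C₃-irrefl zero             = refl
    C₃-irrefl (suc zero)       = refl
    C₃-irrefl (suc (suc zero)) = refl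

    f-adj : ∀ i j → adj G (f i) (f j) ≡ adj (C 3) i j
    f-adj i j with i Fin.≟ j
    ... | yes refl = trans (irrefl (f i)) (sym (C₃-irrefl i))
    ... | no i≢j   = trans (f-~ i≢j) (sym (C₃-complete i≢j))

  ≁ : ∀ {u v} → adj G u v ≡ false → ¬ u ~ v
  ≁ ne e with () ← trans (sym e) ne

  -- Counting the bags of a complete bipartite model

  module _ (triangle-free : TriangleFree) {a b : ℕ} (M : Model (K a b) G) where

    A : Fin a → V → Set
    A i = bag M (i ↑ˡ b)

    B : Fin b → V → Set
    B j = bag M (a ↑ʳ j)

    left : ∀ (i : Fin a) → (toℕ (i ↑ˡ b) <ᵇ a) ≡ true
    left i = Equivalence.to Bool.T-≡ (ℕ.<⇒<ᵇ (subst (_< a) (sym (Fin.toℕ-↑ˡ i b)) (Fin.toℕ<n i)))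

    right : ∀ (j : Fin b) → (toℕ (a ↑ʳ j) <ᵇ a) ≡ false
    right j = Bool.¬-not λ e → ℕ.m+n≮m a (toℕ j)
      (subst (_< a) (Fin.toℕ-↑ʳ a j) (ℕ.<ᵇ⇒< _ _ (Equivalence.from Bool.T-≡ e)))

    anticomplete : ∀ {s t} → s ≢ t → adj (K a b) s t ≡ false → Anticomplete (bag M s) (bag M t)
    anticomplete s≢t st u∈ v∈ = (λ { refl → s≢t (disjoint M u∈ v∈) }) , ≁ (nonedge M s≢t st u∈ v∈)

    AA : ∀ {i j : Fin a} → i ≢ j → Anticomplete (A i) (A j)
    AA {i} {j} i≢j = anticomplete (i≢j ∘ Fin.↑ˡ-injective b _ _) (cong₂ _xor_ (left i) (left j))

    BB : ∀ {i j : Fin b} → i ≢ j → Anticomplete (B i) (B j)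
    BB {i} {j} i≢j = anticomplete (i≢j ∘ Fin.↑ʳ-injective a _ _) (cong₂ _xor_ (right i) (right j))

    A∩B : ∀ {i : Fin a} {j : Fin b} {v} → A i v → ¬ B j v
    A∩B {i} {j} Av Bv with () ←
      trans (sym (left i)) (trans (cong (λ s → toℕ s <ᵇ a) (disjoint M Av Bv)) (right j))

    AB : ∀ i j → ∃[ u ] (A i u × Touches (B j) u)
    AB i j with u , v , Au , Bv , e ← edge M {i ↑ˡ b} {a ↑ʳ j} (cong₂ _xor_ (left i) (right j)) =
      u , Au , v , Bv , e

    -- Since long links can be flipped, only pairs with `j < k` occur, which halves the number of
    -- boxes.
    Outcome : Fin a → Set₁
    Outcome i = (Σ (Fin b × Fin b) λ (j , k) → j Fin.< k × LongLink (A i) (B j) (B k))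
              ⊎ EdgeCover (A i) B

    -- The index `j₀` supplies the root of the growth: a vertex of `A i` that touches `B j₀`.
    outcome : Fin b → ∀ i → Outcome i
    outcome j₀ i
      with link-or-cover triangle-free (λ j → bag? M _) (proj₁ (proj₂ (AB i j₀))) (connected M) (AB i)
    ... | inj₂ c = inj₂ c
    ... | inj₁ (j , k , j≢k , L) with Fin.<-cmp j k
    ... | tri< j<k _ _ = inj₁ ((j , k) , j<k , L)
    ... | tri≈ _ j≡k _ = contradiction j≡k j≢k
    ... | tri> _ _ k<j = inj₁ ((k , j) , k<j , flip L)

    Box : Set
    Box = Maybe (Fin b × Fin b)

    box : ∀ {i} → Outcome i → Box
    box (inj₁ (jk , _)) = just jk
    box (inj₂ _)        = nothing

    boxes : List Box
    boxes = nothing ∷ map just (filter (λ (j , k) → j Fin.<? k)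
                                       (cartesianProduct (allFin b) (allFin b)))

    -- Two covers suffice for a theta, whereas long links for the same pair are needed three times.
    capacity : Box → ℕ
    capacity nothing  = 1
    capacity (just _) = 2

    boxed : ∀ {i} (o : Outcome i) → box o ∈ boxes
    boxed (inj₁ (_ , j<k , _)) =
      there (∈-map⁺ just (∈-filter⁺ (λ (j , k) → j Fin.<? k)
                                    (∈-cartesianProduct⁺ (∈-allFin _) (∈-allFin _)) j<k))
    boxed (inj₂ _) = here refl

    unbox-link : ∀ {i j k} (o : Outcome i) → box o ≡ just (j , k) →
                 j Fin.< k × LongLink (A i) (B j) (B k)
    unbox-link (inj₁ (_ , L)) refl = L

    unbox-cover : ∀ {i} (o : Outcome i) → box o ≡ nothing → EdgeCover (A i) B
    unbox-cover (inj₂ c) refl = c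

    outcomes⇒theta : (∀ i → Outcome i) → 8 < b → sum (map capacity boxes) < a → HasTheta
    outcomes⇒theta o 8<b many =
      conclude (overfull boxes (allFin a) (allFin⁺ a) (λ {i} _ → boxed (o i))
                 (subst (sum (map capacity boxes) <_) (sym (length-tabulate {n = a} id)) many))
      where
      open Pigeonhole (Maybe.≡-dec (Product.≡-dec Fin._≟_ Fin._≟_)) (λ i → box (o i)) capacity

      conclude : ∃[ x ] ∃[ is ] (Unique is × All (λ i → box (o i) ≡ x) is × capacity x < length is) →
                 HasTheta
      conclude (nothing , is , unique , same , more)
        with i , j , i≢j , ei , ej ← pick-two unique same more =
        covers⇒theta {A = A i} {A j} {B} 8<b (AA {i} {j} i≢j) (λ _ → connected M)
          (λ {k} {l} → BB {k} {l}) (unbox-cover (o i) ei) (unbox-cover (o j) ej)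
      conclude (just (j , k) , is , unique , same , more)
        with h , distinct , e ← pick-three unique same more =
        links⇒theta triangle-free {A = λ i → A (h i)} {B j} {B k} (connected M) (connected M)
          (BB {j} {k} (Fin.<⇒≢ (proj₁ (unbox-link (o (h zero)) (e zero)))))
          (λ {i} {i′} i≢ → AA {h i} {h i′} (distinct i≢))
          (λ {i} → A∩B {h i} {j}) (λ {i} → A∩B {h i} {k}) (λ i → proj₂ (unbox-link (o (h i)) (e i)))

    model⇒theta : 8 < b → sum (map capacity boxes) < a → HasTheta
    model⇒theta 8<b = outcomes⇒theta (outcome (fromℕ< 8<b)) 8<b

theorem1p2 : (G : Graph) → IsSimple G → K 134 12 ≼ G →
    (∃[ k ] (3 ≤ k × k ≤ 12 × C k ⊑ᵢ G))
    ⊎ (∃[ x ] ∃[ y ] ∃[ z ] (1 ≤ x × 1 ≤ y × 1 ≤ z × Theta x y z ⊑ᵢ G))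
theorem1p2 G simple minor
  with Fin.any? (λ u → Fin.any? (λ v → Fin.any? (λ w → (u ~? v) ×-dec (v ~? w) ×-dec (u ~? w))))
  where open InGraph G simple
... | yes (u , v , w , uv , vw , uw) =
  inj₁ (3 , ℕ.≤-refl , ℕ.m≤m+n 3 9 , InGraph.triangle G simple uv vw uw)
... | no none =
  inj₂ (InGraph.model⇒theta G simple (λ uv vw uw → none (_ , _ , _ , uv , vw , uw))
         -- The first inequality is `8 < 12`. For the second, the capacities compute to 1 + 2 · 66 =
         -- 133, and `133 < 134` unfolds to `134 ≤ 134`.
         (≼⇒Model simple minor) (ℕ.m≤m+n 9 3) ℕ.≤-refl)
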